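{- Suppose there exists a positive integer $n$ such that $[n]$ admits no $3$-good partition, and let $n$ be the smallest such integer. Then $n\ge 845$, and $n$ belongs to the set $$N_o=\{n: n\equiv 2 \pmod 3\}\cap\{n : 3^t+1<n<(3^{t+1}+1)/2 \text{ for some integer } t\ge 4\}.$$
   Context: A partition of $[n]=\{1,\dots,n\}$ into nonempty parts is called $3$-good if every part has at most $3$ elements and the sum of the elements of every part is a power of $3$, i.e. equals $3^s$ for some integer $s\ge 0$ (so the singleton $\{1\}$ is allowed). The bound $n\ge 845$ rests on a computer verification that $[n]$ admits a $3$-good partition for all $n\le 844$. -}

module Defs where

open import Data.List.Base using (List; concat; length; map; sum; upTo)
open import Data.List.Relation.Binary.Permutation.Propositional using (_↭_)
open import Data.List.Relation.Unary.All using (All)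
open import Data.Nat.Base using (ℕ; suc; _+_; _^_; _≤_; _<_)
open import Data.Nat.DivMod using (_/_; _%_)
open import Data.Product.Base using (_×_; ∃-syntax)
open import Level using (Level; 0ℓ)
open import Relation.Binary.PropositionalEquality.Core using (_≡_)
open import Relation.Nullary.Negation.Core using (¬_)
open import Relation.Unary using (Pred; _∩_)

private
  variable
    ℓ : Level

[1⋯_] : ℕ → List ℕ
[1⋯ n ] = map suc (upTo n)

-- A partition of {1,…,n} is given by a list of its parts, each part being
-- a list of its elements.  Since [1⋯ n ] has no repetitions, the permutation
-- condition says that every element of {1,…,n} occurs exactly once in exactly
-- one part, and that nothing else occurs.  Hence the length and the sum of the
-- list representing a part are the cardinality and the sum of the part.
record IsPartition (n : ℕ) (parts : List (List ℕ)) : Set where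
  field
    nonempty : All (λ part → 1 ≤ length part) parts
    covers   : concat parts ↭ [1⋯ n ]

IsPowerOf3 : Pred ℕ 0ℓ
IsPowerOf3 m = ∃[ s ] m ≡ 3 ^ s

record Is3GoodPartition (n : ℕ) (parts : List (List ℕ)) : Set where
  field
    isPartition : IsPartition n parts
    size≤3      : All (λ part → length part ≤ 3) parts
    sumPower    : All (λ part → IsPowerOf3 (sum part)) parts

Admits3GoodPartition : Pred ℕ 0ℓ
Admits3GoodPartition n = ∃[ parts ] Is3GoodPartition n parts

record IsSmallestPositive (P : Pred ℕ ℓ) (n : ℕ) : Set ℓ where
  field
    positive : 1 ≤ n
    holds    : P n
    smallest : ∀ m → 1 ≤ m → P m → n ≤ m

-- The division by 2 is exact, since 3 ^ (t + 1) is odd.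
Nₒ : Pred ℕ 0ℓ
Nₒ = (λ n → n % 3 ≡ 2)
   ∩ (λ n → ∃[ t ] 4 ≤ t × 3 ^ t + 1 < n × n < (3 ^ (t + 1) + 1) / 2)

AdmitsNo3GoodPartition : Pred ℕ 0ℓ
AdmitsNo3GoodPartition n = ¬ Admits3GoodPartition n

{-# OPTIONS --safe #-}
module Submission where

-- Let B = 3 ^ t with B ≤ n < 3 * B.  If 3 * B < 2 * n, the pairs {x, 3 * B − x} reduce n to a smaller
-- m.  Otherwise n = B + d with 2 * d < B, and the numbers B + u with −d ≤ u ≤ d are split into triples
-- of sum 3 * B, that is, with zero sum in u: all of them if d ≡ 1 mod 3, and all but the singleton
-- {B} if d ≡ 0 mod 3.  In both cases two arithmetic families of triples suffice.  Since t ≥ 1 makes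
-- d ≡ 2 equivalent to n ≡ 2 mod 3, only the exceptional set remains, and its elements up to 844 are
-- dealt with by a table that depends on d but not on t.

import Algebra.Solver.CommutativeMonoid as CommutativeMonoidSolver
open import Data.Bool.Base using (_∧_; not)
open import Data.Fin.Patterns using (0F; 1F; 2F; 3F; 4F; 5F; 6F)
open import Data.List.Base
  using (List; []; _∷_; _++_; _∷ʳ_; [_]; applyUpTo; concat; filterᵇ; length; map)
open import Data.List.Properties using (++-assoc; concat-++; map-upTo; ≡-dec)
open import Data.List.Relation.Binary.Permutation.Propositional
  using (_↭_; prep; ↭-refl; ↭-sym; ↭-trans; ↭-reflexive; module PermutationReasoning)
open import Data.List.Relation.Binary.Permutation.Propositional.Properties
  using (++⁺; ++⁺ˡ; ++⁺ʳ; ++-comm; shift; ∷↭∷ʳ; ++-commutativeMonoid)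
open import Data.List.Relation.Unary.All as All using (All; []; _∷_)
import Data.List.Relation.Unary.All.Properties as All
open import Data.Nat.Base
open import Data.Nat.DivMod using (_/_; _%_; DivMod; _divMod_; result; [m+kn]%n≡m%n; m*n/n≡m)
open import Data.Nat.ListAction using (sum)
open import Data.Nat.Properties
open import Data.List.Sort.MergeSort.Base ≤-decTotalOrder using (sort)
open import Data.List.Sort.MergeSort.Properties ≤-decTotalOrder using (sort-↭)
open import Data.Nat.Tactic.RingSolver using (solve-∀)
open import Data.Product.Base using (_×_; _,_; ∃-syntax; proj₁; proj₂)
open import Data.Sum.Base using (_⊎_; inj₁; inj₂)
open import Data.Vec.Base using ([]; _∷_)
open import Function.Base using (_∘_)
open import Relation.Binary.PropositionalEquality
  using (_≡_; refl; sym; trans; cong; cong₂; subst; module ≡-Reasoning)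
open import Relation.Nullary using (¬_; Dec; yes; no; contradiction)
open import Relation.Nullary.Decidable using (True; toWitness; _×-dec_)
open import Relation.Unary using (_∈_)
open import Defs

private
  module Solver = CommutativeMonoidSolver (++-commutativeMonoid {A = ℕ})

-- The obstacle is a count modulo 3. There are 2d + 1 offsets u with -d ≤ u ≤ d, and 2d + 1 ≡ 1, 0,
-- 2 mod 3 for d ≡ 0, 1, 2. Hence all of them can go into triples only if d ≡ 1, and all but u = 0
-- only if d ≡ 0. For d ≡ 2 neither count is divisible by 3, so some smaller numbers have to be
-- drawn in. Trading two negative offsets for one new one leaves 2d - 1 offsets, a multiple of 3,
-- but it disturbs the numbers up to d. Repairing these depends on how d itself lies between powers
-- of 3, which is why tabulated data take over there. The bound 845 is where the table stops: 3^6 +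
-- 2 + 3 * 38 = 845 is the first exceptional number whose reduction is not checked.

Good : List ℕ → Set
Good part = 1 ≤ length part × length part ≤ 3 × IsPowerOf3 (sum part)

-- Blocks of consecutive integers.

interval : ℕ → ℕ → List ℕ
interval a zero    = []
interval a (suc k) = a ∷ interval (suc a) k

interval-++ : ∀ a k l → interval a (k + l) ≡ interval a k ++ interval (a + k) l
interval-++ a zero    l = cong (λ b → interval b l) (sym (+-identityʳ a))
interval-++ a (suc k) l = cong (a ∷_) (trans (interval-++ (suc a) k l)
  (cong (λ b → interval (suc a) k ++ interval b l) (sym (+-suc a k))))

interval-∷ʳ : ∀ a k → interval a (suc k) ≡ interval a k ∷ʳ (a + k)
interval-∷ʳ a k = trans (cong (interval a) (+-comm 1 k)) (interval-++ a k 1)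

applyUpTo≡interval : ∀ (f : ℕ → ℕ) a k → (∀ i → f i ≡ a + i) → applyUpTo f k ≡ interval a k
applyUpTo≡interval f a zero    eq = refl
applyUpTo≡interval f a (suc k) eq = cong₂ _∷_ (trans (eq 0) (+-identityʳ a))
  (applyUpTo≡interval (f ∘ suc) (suc a) k (λ i → trans (eq (suc i)) (+-suc a i)))

[1⋯n]≡interval : ∀ n → [1⋯ n ] ≡ interval 1 n
[1⋯n]≡interval n = trans (map-upTo suc n) (applyUpTo≡interval suc 1 n (λ _ → refl))

-- Splitting off a final segment, and minimality.

Reduction : ℕ → ℕ → Set
Reduction m k = ∃[ parts ] All Good parts × concat parts ↭ interval (suc m) k

-- The condition `0 < k` makes `m` strictly smaller than `n`, as the appeal to minimality requires.
Reducible : ℕ → Set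
Reducible n = ∃[ m ] ∃[ k ] 0 < k × n ≡ m + k × Reduction m k

extend : ∀ {m k} → Reduction m k → Admits3GoodPartition m → Admits3GoodPartition (m + k)
extend {m} {k} (parts , good , covers) (parts′ , good′) = parts′ ++ parts , record
  { isPartition = record
    { nonempty = All.++⁺ nonempty (All.map proj₁ good)
    ; covers   = begin
        concat (parts′ ++ parts)            ≡⟨ concat-++ parts′ parts ⟨
        concat parts′ ++ concat parts       ↭⟨ ++⁺ covers′ covers ⟩
        [1⋯ m ] ++ interval (suc m) k       ≡⟨ cong (_++ interval (suc m) k) ([1⋯n]≡interval m) ⟩
        interval 1 m ++ interval (suc m) k  ≡⟨ interval-++ 1 m k ⟨
        interval 1 (m + k)                  ≡⟨ [1⋯n]≡interval (m + k) ⟨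
        [1⋯ m + k ]                         ∎
    }
  ; size≤3      = All.++⁺ size≤3 (All.map (proj₁ ∘ proj₂) good)
  ; sumPower    = All.++⁺ sumPower (All.map (proj₂ ∘ proj₂) good)
  }
  where
  open Is3GoodPartition good′
  open IsPartition isPartition using (nonempty) renaming (covers to covers′)
  open PermutationReasoning

admits-0 : Admits3GoodPartition 0
admits-0 = [] , record
  { isPartition = record { nonempty = [] ; covers = ↭-refl }
  ; size≤3      = []
  ; sumPower    = []
  }

-- A partition of [m] would extend to one of [n]; since the property is a negation, its validity for
-- n passes down to m by composing with `extend`, against minimality.
smallest-irreducible : ∀ {n} → IsSmallestPositive AdmitsNo3GoodPartition n → ¬ Reducible n
-- Minimality speaks only of positive numbers, so m = 0 is settled by the empty partition.
smallest-irreducible least (zero , k , 0<k , refl , red) =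
  IsSmallestPositive.holds least (extend red admits-0)
smallest-irreducible least (suc m , k , 0<k , refl , red) =
  <⇒≱ (m<m+n (suc m) 0<k) (IsSmallestPositive.smallest least (suc m) (s≤s z≤n)
    (IsSmallestPositive.holds least ∘ extend red))

-- Nested pairs of constant sum.

pairs : ℕ → ℕ → List (List ℕ)
pairs a zero    = []
pairs a (suc k) = (a ∷ a + suc (2 * k) ∷ []) ∷ pairs (suc a) k

-- Moving one pair inward turns (a, k + 1) into (a + 1, k), so a + k is invariant, and with it the
-- common sum of the pairs.
pairs-good : ∀ a k → IsPowerOf3 (2 * (a + k) ∸ 1) → All Good (pairs a k)
pairs-good a zero    _           = []
pairs-good a (suc k) (s , power) =
  (s≤s z≤n , s≤s (s≤s z≤n) , s , trans (head-sum a k) power) ∷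
  pairs-good (suc a) k (s , trans (cong (λ b → 2 * b ∸ 1) (sym (+-suc a k))) power)
  where
  head-sum : ∀ a k → a + (a + suc (2 * k) + 0) ≡ 2 * (a + suc k) ∸ 1
  head-sum a k = trans (lemma a k) (cong (λ b → 2 * b ∸ 1) (sym (+-suc a k)))
    where
    lemma : ∀ a k → a + (a + suc (2 * k) + 0) ≡ a + k + suc (a + k + 0)
    lemma = solve-∀

pairs-cover : ∀ a k → concat (pairs a k) ↭ interval a (2 * k)
pairs-cover a zero    = ↭-refl
pairs-cover a (suc k) = begin
  a ∷ a + suc (2 * k) ∷ concat (pairs (suc a) k)
    ↭⟨ prep a (prep _ (pairs-cover (suc a) k)) ⟩
  a ∷ a + suc (2 * k) ∷ interval (suc a) (2 * k)
    ↭⟨ prep a (∷↭∷ʳ _ _) ⟩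
  a ∷ interval (suc a) (2 * k) ∷ʳ (a + suc (2 * k))
    ≡⟨ cong (λ b → a ∷ interval (suc a) (2 * k) ∷ʳ b) (+-suc a (2 * k)) ⟩
  a ∷ interval (suc a) (2 * k) ∷ʳ (suc a + 2 * k)
    ≡⟨ cong (a ∷_) (interval-∷ʳ (suc a) (2 * k)) ⟨
  interval a (2 + 2 * k)
    ≡⟨ cong (interval a) (*-suc 2 k) ⟨
  interval a (2 * suc k) ∎
  where open PermutationReasoning

-- Triples of constant sum.

descending : ℕ → ℕ → List ℕ
descending a zero    = []
descending a (suc k) = a + 2 * k ∷ descending a k

-- The third elements of one family of triples have a fixed parity. Two families that end at
-- consecutive numbers therefore fill a block between them.
descending-interleave : ∀ a k → descending a k ++ descending (suc a) k ↭ interval a (2 * k)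
descending-interleave a zero    = ↭-refl
descending-interleave a (suc k) = begin
  a + 2 * k ∷ (descending a k ++ suc a + 2 * k ∷ descending (suc a) k)
    ↭⟨ prep _ (shift _ (descending a k) (descending (suc a) k)) ⟩
  a + 2 * k ∷ suc (a + 2 * k) ∷ (descending a k ++ descending (suc a) k)
    ↭⟨ prep _ (prep _ (descending-interleave a k)) ⟩
  (a + 2 * k ∷ suc (a + 2 * k) ∷ []) ++ interval a (2 * k)
    ↭⟨ ++-comm (a + 2 * k ∷ suc (a + 2 * k) ∷ []) (interval a (2 * k)) ⟩
  interval a (2 * k) ++ interval (a + 2 * k) 2
    ≡⟨ interval-++ a (2 * k) 2 ⟨
  interval a (2 * k + 2)
    ≡⟨ cong (interval a) (trans (+-comm (2 * k) 2) (sym (*-suc 2 k))) ⟩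
  interval a (2 * suc k) ∎
  where open PermutationReasoning

-- The variant for families of unequal size, needed when d ≡ 1 mod 3, where one family has a triple
-- more.
descending-interleave′ : ∀ a k → descending a (suc k) ++ descending (suc a) k ↭ interval a (suc (2 * k))
descending-interleave′ a k = begin
  a + 2 * k ∷ (descending a k ++ descending (suc a) k) ↭⟨ prep _ (descending-interleave a k) ⟩
  a + 2 * k ∷ interval a (2 * k)                       ↭⟨ ∷↭∷ʳ _ _ ⟩
  interval a (2 * k) ∷ʳ (a + 2 * k)                    ≡⟨ interval-∷ʳ a (2 * k) ⟨
  interval a (suc (2 * k))                             ∎
  where open PermutationReasoning

-- All parts have the same sum: while x and y increase by 1, the third element decreases by 2 to z.
triples : ℕ → ℕ → ℕ → ℕ → List (List ℕ)
triples zero    x y z = []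
triples (suc k) x y z = (x ∷ y ∷ z + 2 * k ∷ []) ∷ triples k (suc x) (suc y) z

-- The first triple has sum x + y + z + 2 * (k - 1); adding 2 on both sides avoids the subtraction.
-- Passing to the tail raises x and y by 1 and lowers k by 1, which preserves the left side.
triples-good : ∀ k x y z {S} → IsPowerOf3 S → x + y + z + 2 * k ≡ 2 + S →
  All Good (triples k x y z)
triples-good zero    x y z power eq = []
triples-good (suc k) x y z {S} (s , power) eq =
  (s≤s z≤n , ≤-refl , s ,
   trans (+-cancelˡ-≡ 2 _ _ (trans (head-sum x y z k) eq)) power) ∷
  triples-good k (suc x) (suc y) z (s , power) (trans (tail-sum x y z k) eq)
  where
  head-sum : ∀ x y z k → 2 + (x + (y + (z + 2 * k + 0))) ≡ x + y + z + 2 * suc k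
  head-sum = solve-∀
  tail-sum : ∀ x y z k → suc x + suc y + z + 2 * k ≡ x + y + z + 2 * suc k
  tail-sum = solve-∀

triples-cover : ∀ k x y z → concat (triples k x y z) ↭ interval x k ++ interval y k ++ descending z k
triples-cover zero    x y z = ↭-refl
triples-cover (suc k) x y z = prep x (begin
  y ∷ z + 2 * k ∷ concat (triples k (suc x) (suc y) z)  ↭⟨ prep _ (prep _ (triples-cover k (suc x) (suc y) z)) ⟩
  y ∷ z + 2 * k ∷ (X ++ Y ++ Z)                         ≡⟨ cong (λ l → y ∷ z + 2 * k ∷ l) (++-assoc X Y Z) ⟨
  y ∷ z + 2 * k ∷ ((X ++ Y) ++ Z)                       ↭⟨ prep _ (shift _ (X ++ Y) Z) ⟨
  y ∷ ((X ++ Y) ++ z + 2 * k ∷ Z)                       ≡⟨ cong (y ∷_) (++-assoc X Y (z + 2 * k ∷ Z)) ⟩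
  y ∷ (X ++ (Y ++ z + 2 * k ∷ Z))                       ↭⟨ shift y X _ ⟨
  X ++ (y ∷ Y ++ z + 2 * k ∷ Z)                         ∎)
  where
  open PermutationReasoning
  X = interval (suc x) k
  Y = interval (suc y) k
  Z = descending z k

-- The three uniform reductions.

reduction-pairs : ∀ m k → IsPowerOf3 (suc (2 * (m + k))) → Reduction m (2 * k)
reduction-pairs m k (s , power) =
  pairs (suc m) k ,
  pairs-good (suc m) k (s , trans (+-suc (m + k) (m + k + 0)) power) ,
  pairs-cover (suc m) k

-- Here d = 3e. In offsets from B the families are (-3e + i, 1 + i, 3e - 1 - 2i) and (-2e + i, -e +
-- i, 3e - 2i) for 0 ≤ i < e, each with zero sum. Their first two entries fill four blocks of length
-- e, namely -3e to -1 and 1 to e; the third entries interleave to e + 1, ..., 3e. The length is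
-- written as a nested sum so that `interval-++` can peel off these blocks.
reduction-≡0 : ∀ m e (let B = suc m + e + e + e) → IsPowerOf3 B →
  Reduction m (e + (e + (e + suc (e + 2 * e))))
reduction-≡0 m e (s , power) =
  triples e c₀ c₃ c₄ ++ triples e c₁ c₂ (suc c₄) ++ [ [ B ] ] ,
  All.++⁺ (triples-good e c₀ c₃ c₄ 3B (sum₁ m e))
    (All.++⁺ (triples-good e c₁ c₂ (suc c₄) 3B (sum₂ m e))
      ((s≤s z≤n , s≤s z≤n , s , trans (+-identityʳ B) power) ∷ [])) ,
  (begin
    concat (triples e c₀ c₃ c₄ ++ triples e c₁ c₂ (suc c₄) ++ [ [ B ] ])
      ≡⟨ concat-++ (triples e c₀ c₃ c₄) _ ⟨
    concat (triples e c₀ c₃ c₄) ++ concat (triples e c₁ c₂ (suc c₄) ++ [ [ B ] ])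
      ≡⟨ cong (concat (triples e c₀ c₃ c₄) ++_) (concat-++ (triples e c₁ c₂ (suc c₄)) _) ⟨
    concat (triples e c₀ c₃ c₄) ++ concat (triples e c₁ c₂ (suc c₄)) ++ [ B ]
      ↭⟨ ++⁺ (triples-cover e c₀ c₃ c₄) (++⁺ (triples-cover e c₁ c₂ (suc c₄)) ↭-refl) ⟩
    (I₀ ++ I₃ ++ D₀) ++ (I₁ ++ I₂ ++ D₁) ++ [ B ]
      -- Only whole blocks move, into the order in which they lie in the interval; `D₀` and `D₁`
      -- share the last block and are merged in the next step.
      ↭⟨ prove 7 ((i₀ ⊕ i₃ ⊕ d₀) ⊕ (i₁ ⊕ i₂ ⊕ d₁) ⊕ b) (i₀ ⊕ i₁ ⊕ i₂ ⊕ b ⊕ i₃ ⊕ d₀ ⊕ d₁)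
           (I₀ ∷ I₁ ∷ I₂ ∷ [ B ] ∷ I₃ ∷ D₀ ∷ D₁ ∷ []) ⟩
    I₀ ++ I₁ ++ I₂ ++ [ B ] ++ I₃ ++ D₀ ++ D₁
      ↭⟨ ++⁺ˡ I₀ (++⁺ˡ I₁ (++⁺ˡ I₂ (++⁺ˡ [ B ] (++⁺ˡ I₃ (descending-interleave c₄ e))))) ⟩
    I₀ ++ I₁ ++ I₂ ++ [ B ] ++ I₃ ++ interval c₄ (2 * e)
      ≡⟨ cong (λ l → I₀ ++ I₁ ++ I₂ ++ B ∷ l) (interval-++ c₃ e _) ⟨
    I₀ ++ I₁ ++ I₂ ++ interval B (suc (e + 2 * e))
      ≡⟨ cong (λ l → I₀ ++ I₁ ++ l) (interval-++ c₂ e _) ⟨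
    I₀ ++ I₁ ++ interval c₂ (e + suc (e + 2 * e))
      ≡⟨ cong (I₀ ++_) (interval-++ c₁ e _) ⟨
    I₀ ++ interval c₁ (e + (e + suc (e + 2 * e)))
      ≡⟨ interval-++ c₀ e _ ⟨
    interval c₀ (e + (e + (e + suc (e + 2 * e)))) ∎)
  where
  open PermutationReasoning
  open Solver
  c₀ = suc m ; c₁ = c₀ + e ; c₂ = c₁ + e ; B = c₂ + e ; c₃ = suc B ; c₄ = c₃ + e
  I₀ = interval c₀ e ; I₁ = interval c₁ e ; I₂ = interval c₂ e ; I₃ = interval c₃ e
  D₀ = descending c₄ e ; D₁ = descending (suc c₄) e
  i₀ = var 0F ; i₁ = var 1F ; i₂ = var 2F ; b = var 3F ; i₃ = var 4F ; d₀ = var 5F ; d₁ = var 6F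
  3B : IsPowerOf3 (3 * B)
  3B = suc s , cong (3 *_) power
  sum₁ : ∀ m e → suc m + suc (suc m + e + e + e) + (suc (suc m + e + e + e) + e) + 2 * e
               ≡ 2 + 3 * (suc m + e + e + e)
  sum₁ = solve-∀
  sum₂ : ∀ m e → suc m + e + (suc m + e + e) + suc (suc (suc m + e + e + e) + e) + 2 * e
               ≡ 2 + 3 * (suc m + e + e + e)
  sum₂ = solve-∀

-- Here d = 3e + 1. In offsets from B the families are (2e + 1 + i, -e + i, -e - 1 - 2i) for 0 ≤ i ≤
-- e and (e + 1 + i, 1 + i, -e - 2 - 2i) for 0 ≤ i < e. The interleaved block is now the lowest one,
-- -3e - 1 to -e - 1. B itself occurs in the triple i = e of the first family, (3e + 1, 0, -3e - 1).
reduction-≡1 : ∀ m e (let B = suc m + suc (2 * e) + e) → IsPowerOf3 B →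
  Reduction m (suc (2 * e) + (suc e + (e + (e + suc e))))
reduction-≡1 m e (s , power) =
  triples (suc e) c₄ c₁ c₀ ++ triples e c₃ c₂ (suc c₀) ,
  All.++⁺ (triples-good (suc e) c₄ c₁ c₀ 3B (sum₁ m e)) (triples-good e c₃ c₂ (suc c₀) 3B (sum₂ m e)) ,
  (begin
    concat (triples (suc e) c₄ c₁ c₀ ++ triples e c₃ c₂ (suc c₀))
      ≡⟨ concat-++ (triples (suc e) c₄ c₁ c₀) _ ⟨
    concat (triples (suc e) c₄ c₁ c₀) ++ concat (triples e c₃ c₂ (suc c₀))
      ↭⟨ ++⁺ (triples-cover (suc e) c₄ c₁ c₀) (triples-cover e c₃ c₂ (suc c₀)) ⟩
    (I₄ ++ I₁ ++ D₀) ++ (I₃ ++ I₂ ++ D₁)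
      ↭⟨ prove 6 ((i₄ ⊕ i₁ ⊕ d₀) ⊕ (i₃ ⊕ i₂ ⊕ d₁)) ((d₀ ⊕ d₁) ⊕ i₁ ⊕ i₂ ⊕ i₃ ⊕ i₄)
           (D₀ ∷ D₁ ∷ I₁ ∷ I₂ ∷ I₃ ∷ I₄ ∷ []) ⟩
    (D₀ ++ D₁) ++ I₁ ++ I₂ ++ I₃ ++ I₄
      ↭⟨ ++⁺ʳ (I₁ ++ I₂ ++ I₃ ++ I₄) (descending-interleave′ c₀ e) ⟩
    I₀ ++ I₁ ++ I₂ ++ I₃ ++ I₄
      ≡⟨ cong (λ l → I₀ ++ I₁ ++ I₂ ++ l) (interval-++ c₃ e _) ⟨
    I₀ ++ I₁ ++ I₂ ++ interval c₃ (e + suc e)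
      ≡⟨ cong (λ l → I₀ ++ I₁ ++ l) (interval-++ c₂ e _) ⟨
    I₀ ++ I₁ ++ interval c₂ (e + (e + suc e))
      ≡⟨ cong (I₀ ++_) (interval-++ c₁ (suc e) _) ⟨
    I₀ ++ interval c₁ (suc e + (e + (e + suc e)))
      ≡⟨ interval-++ c₀ (suc (2 * e)) _ ⟨
    interval c₀ (suc (2 * e) + (suc e + (e + (e + suc e)))) ∎)
  where
  open PermutationReasoning
  open Solver
  c₀ = suc m ; c₁ = c₀ + suc (2 * e) ; c₂ = c₁ + suc e ; c₃ = c₂ + e ; c₄ = c₃ + e
  I₀ = interval c₀ (suc (2 * e)) ; I₁ = interval c₁ (suc e) ; I₂ = interval c₂ e
  I₃ = interval c₃ e ; I₄ = interval c₄ (suc e)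
  D₀ = descending c₀ (suc e) ; D₁ = descending (suc c₀) e
  d₀ = var 0F ; d₁ = var 1F ; i₁ = var 2F ; i₂ = var 3F ; i₃ = var 4F ; i₄ = var 5F
  3B : IsPowerOf3 (3 * (c₁ + e))
  3B = suc s , cong (3 *_) power
  sum₁ : ∀ m e → suc m + suc (2 * e) + suc e + e + e + (suc m + suc (2 * e)) + suc m + 2 * suc e
               ≡ 2 + 3 * (suc m + suc (2 * e) + e)
  sum₁ = solve-∀
  sum₂ : ∀ m e → suc m + suc (2 * e) + suc e + e + (suc m + suc (2 * e) + suc e) + suc (suc m) + 2 * e
               ≡ 2 + 3 * (suc m + suc (2 * e) + e)
  sum₂ = solve-∀

-- Certificates for d ≡ 2 mod 3.

complements : ℕ → ℕ → ℕ → List (List ℕ)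
complements S a omitted =
  map (λ x → x ∷ S ∸ x ∷ [])
    -- Both members are tested because the omitted number may exceed S / 2: for B = 27 and d = 11 it
    -- is a + b = 14, and the pair to drop appears as x = 13.
    (filterᵇ (λ x → not (x ≡ᵇ omitted) ∧ not (S ∸ x ≡ᵇ omitted))
      (interval a (suc (S / 2) ∸ a)))

-- For d ≡ 2 mod 3 and B a power of 3 with 2 * d < B, elements near B are written as B + u and a
-- triple has sum 3 * B when its three values of u add up to zero.  The 2 * d nonzero values
-- −d ≤ u ≤ d cannot be split into such triples since 3 does not divide 2 * d, but they can after −a
-- and −b are traded for −(a + b): up lists the triples (x, y, −(x + y)) and down the triples
-- (−x, −y, x + y).  Apart from B, these triples and pairs with sum B, there remain the numbers up to
-- d with a and b replaced by a + b, whose partner B − (a + b) is used in a triple; lower splits them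
-- except for those up to m.
record Certificate : Set where
  constructor certificate
  field
    m a b : ℕ
    lower : List (List ℕ)
    up    : List (ℕ × ℕ)
    down  : List (ℕ × ℕ)

  parts : ℕ → ℕ → List (List ℕ)
  parts B d =
    [ B ] ∷
    (a ∷ B ∸ a ∷ []) ∷
    (b ∷ B ∸ b ∷ []) ∷
    complements B (suc d) (a + b) ++
    lower ++
    map (λ (x , y) → B + x ∷ B + y ∷ B ∸ (x + y) ∷ []) up ++
    map (λ (x , y) → B ∸ x ∷ B ∸ y ∷ B + (x + y) ∷ []) down

  -- Only powers below 3 ^ 8 occur as sums in the range of the table.
  SmallGood : List ℕ → Set
  SmallGood part = 1 ≤ length part × length part ≤ 3 × ∃[ s ] s < 8 × sum part ≡ 3 ^ s

  -- Shaped for evaluation: the bounded exponent makes the power condition decidable, and sorting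
  -- turns the covering permutation into an equality of lists. Nothing has to be proved about the
  -- meaning of the fields or about truncated subtraction, since the resulting parts themselves are
  -- checked.
  Valid : ℕ → ℕ → Set
  Valid B d = m < B + d
            × All SmallGood (parts B d)
            × sort (concat (parts B d)) ≡ interval (suc m) (B + d ∸ m)

  smallGood? : ∀ part → Dec (SmallGood part)
  smallGood? part =
    1 ≤? length part ×-dec length part ≤? 3 ×-dec anyUpTo? (λ s → sum part ≟ 3 ^ s) 8

  valid? : ∀ B d → Dec (Valid B d)
  valid? B d = m <? B + d ×-dec All.all? smallGood? (parts B d) ×-dec ≡-dec _≟_ _ _

  valid⇒reducible : ∀ B d → Valid B d → Reducible (B + d)
  valid⇒reducible B d (m<n , good , sorted) =
    m , B + d ∸ m , m<n⇒0<n∸m m<n , sym (m+[n∸m]≡n (<⇒≤ m<n)) ,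
    parts B d ,
    All.map (λ (1≤ , ≤3 , s , _ , power) → 1≤ , ≤3 , s , power) good ,
    ↭-trans (↭-sym (sort-↭ (concat (parts B d)))) (↭-reflexive sorted)

open Certificate using (valid?; valid⇒reducible)

-- The table.

private
  pattern ⟨_∙_⟩   x y   = x ∷ y ∷ []
  pattern ⟨_∙_∙_⟩ x y z = x ∷ y ∷ z ∷ []

-- Found by computer search; the entry with index q is for d = 2 + 3 * q.
certificates : List Certificate
certificates =
  certificate 0 1 2
    ([ 3 ] ∷ complements 3 1 1)
    ((1 , 2) ∷ [])
    [] ∷
  certificate 3 4 5
    ([ 9 ] ∷ complements 9 4 4)
    ((4 , 5) ∷ (1 , 2) ∷ [])
    ((2 , 1) ∷ []) ∷
  certificate 0 3 6
    ([ 9 ] ∷ complements 9 1 3)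
    ((4 , 5) ∷ (1 , 7) ∷ (2 , 3) ∷ [])
    ((7 , 1) ∷ (4 , 2) ∷ []) ∷
  -- For d = 11, and again for 29 ≤ d ≤ 38 and 83 ≤ d ≤ 119, no power of 3 lies strictly between d
  -- and 2 * d. There a + b is not a power of 3, and `lower` needs triples, the last of which
  -- contains a + b. All other entries take a + b = S, the power of 3 between d and 2 * d: S is a
  -- part by itself, pairs of sum S other than (a, b) use up the remaining numbers down to m + 1,
  -- and m = S - 1 - d.
  certificate 2 3 11
    (⟨ 8 ∙ 9 ∙ 10 ⟩ ∷ ⟨ 4 ∙ 5 ⟩ ∷ ⟨ 7 ∙ 6 ∙ 14 ⟩ ∷ [])
    ((5 , 9) ∷ (2 , 8) ∷ (1 , 7) ∷ (3 , 4) ∷ [])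
    ((9 , 1) ∷ (6 , 5) ∷ (4 , 2) ∷ []) ∷
  certificate 12 13 14
    ([ 27 ] ∷ complements 27 13 13)
    ((13 , 14) ∷ (5 , 7) ∷ (3 , 8) ∷ (1 , 9) ∷ (2 , 6) ∷ [])
    ((9 , 2) ∷ (7 , 5) ∷ (6 , 4) ∷ (3 , 1) ∷ []) ∷
  certificate 9 12 15
    ([ 27 ] ∷ complements 27 10 12)
    ((10 , 17) ∷ (3 , 13) ∷ (5 , 12) ∷ (2 , 11) ∷ (1 , 7) ∷ (4 , 6) ∷ [])
    ((14 , 2) ∷ (11 , 4) ∷ (7 , 1) ∷ (9 , 5) ∷ (6 , 3) ∷ []) ∷
  certificate 6 9 18
    ([ 27 ] ∷ complements 27 7 9)
    ((10 , 17) ∷ (4 , 16) ∷ (2 , 15) ∷ (3 , 12) ∷ (1 , 9) ∷ (5 , 7) ∷ (6 , 8) ∷ [])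
    ((19 , 1) ∷ (16 , 3) ∷ (8 , 6) ∷ (11 , 2) ∷ (13 , 5) ∷ (7 , 4) ∷ []) ∷
  certificate 3 8 19
    ([ 27 ] ∷ complements 27 4 8)
    ((12 , 15) ∷ (5 , 18) ∷ (2 , 20) ∷ (8 , 13) ∷ (4 , 10) ∷ (1 , 16) ∷ (3 , 9) ∷ (6 , 14) ∷ [])
    ((18 , 5) ∷ (15 , 7) ∷ (11 , 10) ∷ (9 , 2) ∷ (16 , 3) ∷ (13 , 4) ∷ (6 , 1) ∷ []) ∷
  certificate 0 2 25
    ([ 27 ] ∷ complements 27 1 2)
    ((2 , 22) ∷ (3 , 16) ∷ (8 , 18) ∷ (10 , 17) ∷ (7 , 14) ∷ (1 , 19) ∷ (5 , 13) ∷ (4 , 12) ∷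
     (6 , 9) ∷ [])
    ((22 , 4) ∷ (17 , 8) ∷ (23 , 1) ∷ (11 , 9) ∷ (13 , 10) ∷ (12 , 3) ∷ (14 , 7) ∷ (6 , 5) ∷ []) ∷
  certificate 0 23 25
    (⟨ 24 ∙ 28 ∙ 29 ⟩ ∷ [ 27 ] ∷ ⟨ 1 ∙ 26 ⟩ ∷ ⟨ 5 ∙ 22 ⟩ ∷ ⟨ 2 ∙ 4 ∙ 21 ⟩ ∷ ⟨ 8 ∙ 19 ⟩ ∷ ⟨ 11 ∙ 16 ⟩ ∷
     ⟨ 9 ∙ 18 ⟩ ∷ ⟨ 12 ∙ 15 ⟩ ∷ ⟨ 10 ∙ 17 ⟩ ∷ ⟨ 6 ∙ 7 ∙ 14 ⟩ ∷ [ 3 ] ∷ ⟨ 20 ∙ 13 ∙ 48 ⟩ ∷ [])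
    ((21 , 27) ∷ (5 , 24) ∷ (8 , 20) ∷ (1 , 26) ∷ (10 , 16) ∷ (4 , 18) ∷ (7 , 12) ∷ (2 , 15) ∷
     (6 , 9) ∷ (3 , 11) ∷ [])
    ((24 , 4) ∷ (21 , 2) ∷ (18 , 11) ∷ (20 , 5) ∷ (13 , 1) ∷ (12 , 7) ∷ (10 , 3) ∷ (9 , 8) ∷
     (16 , 6) ∷ []) ∷
  certificate 3 15 18
    (⟨ 21 ∙ 29 ∙ 31 ⟩ ∷ ⟨ 23 ∙ 28 ∙ 30 ⟩ ∷ ⟨ 24 ∙ 25 ∙ 32 ⟩ ∷ [ 27 ] ∷ ⟨ 7 ∙ 20 ⟩ ∷ ⟨ 8 ∙ 19 ⟩ ∷
     ⟨ 4 ∙ 6 ∙ 17 ⟩ ∷ ⟨ 11 ∙ 16 ⟩ ∷ ⟨ 5 ∙ 10 ∙ 12 ⟩ ∷ ⟨ 13 ∙ 14 ⟩ ∷ [ 9 ] ∷ ⟨ 26 ∙ 22 ∙ 33 ⟩ ∷ [])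
    ((2 , 29) ∷ (6 , 27) ∷ (1 , 28) ∷ (4 , 26) ∷ (5 , 8) ∷ (13 , 19) ∷ (12 , 15) ∷ (11 , 17) ∷
     (3 , 20) ∷ (9 , 16) ∷ (7 , 14) ∷ [])
    ((22 , 10) ∷ (24 , 7) ∷ (26 , 4) ∷ (19 , 5) ∷ (12 , 9) ∷ (14 , 11) ∷ (20 , 3) ∷ (8 , 2) ∷
     (17 , 1) ∷ (16 , 6) ∷ []) ∷
  certificate 0 11 34
    (⟨ 21 ∙ 25 ∙ 35 ⟩ ∷ ⟨ 23 ∙ 28 ∙ 30 ⟩ ∷ [ 27 ] ∷ ⟨ 16 ∙ 32 ∙ 33 ⟩ ∷ ⟨ 24 ∙ 26 ∙ 31 ⟩ ∷ ⟨ 2 ∙ 3 ∙ 22 ⟩ ∷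
     ⟨ 1 ∙ 6 ∙ 20 ⟩ ∷ ⟨ 8 ∙ 19 ⟩ ∷ ⟨ 10 ∙ 17 ⟩ ∷ ⟨ 12 ∙ 15 ⟩ ∷ ⟨ 4 ∙ 5 ∙ 18 ⟩ ∷ ⟨ 13 ∙ 14 ⟩ ∷ [ 9 ] ∷
     ⟨ 7 ∙ 29 ∙ 45 ⟩ ∷ [])
    ((21 , 24) ∷ (13 , 22) ∷ (7 , 26) ∷ (9 , 23) ∷ (11 , 16) ∷ (3 , 14) ∷ (10 , 20) ∷ (5 , 18) ∷
     (2 , 19) ∷ (1 , 15) ∷ (6 , 12) ∷ (4 , 8) ∷ [])
    ((31 , 4) ∷ (20 , 14) ∷ (25 , 8) ∷ (29 , 3) ∷ (28 , 2) ∷ (26 , 1) ∷ (15 , 13) ∷ (19 , 6) ∷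
     (24 , 5) ∷ (22 , 9) ∷ (10 , 7) ∷ []) ∷
  certificate 0 15 25
    (⟨ 17 ∙ 29 ∙ 35 ⟩ ∷ ⟨ 26 ∙ 27 ∙ 28 ⟩ ∷ ⟨ 10 ∙ 33 ∙ 38 ⟩ ∷ ⟨ 16 ∙ 31 ∙ 34 ⟩ ∷ ⟨ 13 ∙ 32 ∙ 36 ⟩ ∷
     ⟨ 20 ∙ 24 ∙ 37 ⟩ ∷ ⟨ 4 ∙ 23 ⟩ ∷ ⟨ 5 ∙ 22 ⟩ ∷ ⟨ 6 ∙ 21 ⟩ ∷ ⟨ 1 ∙ 12 ∙ 14 ⟩ ∷ ⟨ 8 ∙ 19 ⟩ ∷ [ 3 ] ∷
     ⟨ 9 ∙ 18 ⟩ ∷ ⟨ 2 ∙ 7 ⟩ ∷ ⟨ 30 ∙ 11 ∙ 40 ⟩ ∷ [])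
    ((6 , 31) ∷ (10 , 30) ∷ (7 , 26) ∷ (4 , 28) ∷ (9 , 27) ∷ (17 , 21) ∷ (12 , 14) ∷ (11 , 24) ∷
     (5 , 29) ∷ (8 , 15) ∷ (13 , 18) ∷ (2 , 16) ∷ (1 , 20) ∷ [])
    ((27 , 11) ∷ (30 , 7) ∷ (24 , 12) ∷ (22 , 13) ∷ (29 , 5) ∷ (17 , 16) ∷ (28 , 4) ∷ (19 , 6) ∷
     (14 , 8) ∷ (20 , 3) ∷ (10 , 9) ∷ (2 , 1) ∷ []) ∷
  certificate 39 40 41
    ([ 81 ] ∷ complements 81 40 40)
    ((40 , 41) ∷ (12 , 27) ∷ (2 , 36) ∷ (7 , 30) ∷ (8 , 28) ∷ (10 , 23) ∷ (1 , 34) ∷ (11 , 21) ∷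
     (9 , 22) ∷ (14 , 16) ∷ (6 , 13) ∷ (5 , 18) ∷ (3 , 19) ∷ (4 , 17) ∷ [])
    ((34 , 4) ∷ (27 , 10) ∷ (26 , 13) ∷ (25 , 1) ∷ (28 , 3) ∷ (29 , 6) ∷ (8 , 7) ∷ (15 , 9) ∷
     (17 , 16) ∷ (24 , 5) ∷ (20 , 12) ∷ (18 , 2) ∷ (14 , 11) ∷ []) ∷
  certificate 36 39 42
    ([ 81 ] ∷ complements 81 37 39)
    ((38 , 43) ∷ (17 , 27) ∷ (15 , 28) ∷ (16 , 25) ∷ (6 , 34) ∷ (13 , 23) ∷ (12 , 20) ∷
     (10 , 21) ∷ (11 , 19) ∷ (2 , 26) ∷ (9 , 24) ∷ (1 , 3) ∷ (7 , 18) ∷ (8 , 14) ∷ (4 , 22) ∷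
     [])
    ((35 , 9) ∷ (38 , 1) ∷ (37 , 5) ∷ (34 , 6) ∷ (24 , 8) ∷ (29 , 12) ∷ (23 , 7) ∷ (3 , 2) ∷
     (27 , 10) ∷ (21 , 14) ∷ (19 , 17) ∷ (20 , 13) ∷ (16 , 15) ∷ (18 , 11) ∷ []) ∷
  certificate 33 35 46
    ([ 81 ] ∷ complements 81 34 35)
    ((36 , 45) ∷ (5 , 42) ∷ (15 , 29) ∷ (2 , 43) ∷ (19 , 24) ∷ (11 , 31) ∷ (18 , 23) ∷
     (7 , 33) ∷ (12 , 27) ∷ (4 , 28) ∷ (13 , 25) ∷ (10 , 26) ∷ (1 , 20) ∷ (9 , 22) ∷ (6 , 16) ∷
     (3 , 8) ∷ [])
    ((37 , 2) ∷ (34 , 1) ∷ (30 , 17) ∷ (26 , 20) ∷ (25 , 19) ∷ (15 , 6) ∷ (16 , 14) ∷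
     (23 , 18) ∷ (29 , 3) ∷ (9 , 8) ∷ (10 , 4) ∷ (33 , 5) ∷ (24 , 13) ∷ (28 , 12) ∷ (27 , 7) ∷
     []) ∷
  certificate 30 31 50
    ([ 81 ] ∷ complements 81 31 31)
    ((31 , 50) ∷ (5 , 44) ∷ (8 , 40) ∷ (22 , 25) ∷ (18 , 28) ∷ (11 , 34) ∷ (9 , 35) ∷ (6 , 37) ∷
     (12 , 30) ∷ (16 , 23) ∷ (3 , 32) ∷ (4 , 21) ∷ (1 , 33) ∷ (13 , 17) ∷ (7 , 20) ∷ (10 , 19) ∷
     (2 , 14) ∷ [])
    ((41 , 8) ∷ (38 , 4) ∷ (37 , 11) ∷ (32 , 13) ∷ (26 , 21) ∷ (28 , 18) ∷ (36 , 2) ∷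
     (24 , 17) ∷ (40 , 3) ∷ (33 , 6) ∷ (23 , 1) ∷ (19 , 7) ∷ (22 , 14) ∷ (20 , 9) ∷ (15 , 12) ∷
     (10 , 5) ∷ []) ∷
  certificate 27 34 47
    ([ 81 ] ∷ complements 81 28 34)
    ((40 , 41) ∷ (10 , 43) ∷ (13 , 39) ∷ (1 , 50) ∷ (11 , 37) ∷ (22 , 27) ∷ (16 , 30) ∷
     (6 , 36) ∷ (15 , 35) ∷ (5 , 34) ∷ (18 , 25) ∷ (17 , 20) ∷ (2 , 38) ∷ (7 , 23) ∷ (4 , 29) ∷
     (12 , 24) ∷ (3 , 28) ∷ (8 , 14) ∷ [])
    ((45 , 4) ∷ (44 , 7) ∷ (38 , 15) ∷ (28 , 24) ∷ (41 , 5) ∷ (26 , 21) ∷ (32 , 16) ∷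
     (29 , 13) ∷ (35 , 9) ∷ (27 , 18) ∷ (17 , 14) ∷ (19 , 2) ∷ (11 , 8) ∷ (23 , 10) ∷
     (20 , 12) ∷ (25 , 1) ∷ (6 , 3) ∷ []) ∷
  certificate 24 37 44
    ([ 81 ] ∷ complements 81 25 37)
    ((37 , 44) ∷ (10 , 46) ∷ (13 , 42) ∷ (4 , 50) ∷ (15 , 38) ∷ (22 , 30) ∷ (18 , 33) ∷
     (2 , 47) ∷ (7 , 43) ∷ (21 , 26) ∷ (3 , 39) ∷ (9 , 23) ∷ (16 , 24) ∷ (11 , 32) ∷ (1 , 35) ∷
     (12 , 14) ∷ (8 , 31) ∷ (5 , 20) ∷ (6 , 17) ∷ [])
    ((46 , 9) ∷ (45 , 3) ∷ (38 , 18) ∷ (48 , 4) ∷ (41 , 13) ∷ (34 , 19) ∷ (31 , 20) ∷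
     (30 , 10) ∷ (35 , 6) ∷ (27 , 22) ∷ (33 , 12) ∷ (16 , 11) ∷ (29 , 5) ∷ (21 , 7) ∷ (28 , 8) ∷
     (15 , 14) ∷ (24 , 1) ∷ (17 , 2) ∷ []) ∷
  certificate 21 25 56
    ([ 81 ] ∷ complements 81 22 25)
    ((26 , 55) ∷ (9 , 50) ∷ (17 , 41) ∷ (15 , 42) ∷ (19 , 36) ∷ (25 , 28) ∷ (1 , 51) ∷
     (14 , 35) ∷ (11 , 37) ∷ (7 , 44) ∷ (2 , 48) ∷ (12 , 33) ∷ (10 , 31) ∷ (16 , 24) ∷
     (8 , 30) ∷ (4 , 39) ∷ (6 , 29) ∷ (5 , 18) ∷ (13 , 20) ∷ (3 , 23) ∷ [])
    ((54 , 3) ∷ (46 , 1) ∷ (47 , 7) ∷ (42 , 4) ∷ (39 , 14) ∷ (44 , 12) ∷ (32 , 27) ∷ (34 , 24) ∷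
     (37 , 15) ∷ (36 , 9) ∷ (31 , 18) ∷ (20 , 2) ∷ (29 , 11) ∷ (28 , 6) ∷ (22 , 10) ∷
     (30 , 13) ∷ (21 , 17) ∷ (19 , 8) ∷ (16 , 5) ∷ []) ∷
  certificate 18 34 47
    ([ 81 ] ∷ complements 81 19 34)
    ((32 , 49) ∷ (16 , 46) ∷ (23 , 38) ∷ (19 , 41) ∷ (17 , 42) ∷ (6 , 52) ∷ (21 , 36) ∷
     (22 , 30) ∷ (18 , 33) ∷ (3 , 43) ∷ (14 , 34) ∷ (8 , 35) ∷ (13 , 29) ∷ (10 , 31) ∷
     (12 , 28) ∷ (11 , 25) ∷ (9 , 15) ∷ (7 , 26) ∷ (1 , 20) ∷ (4 , 5) ∷ (2 , 24) ∷ [])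
    ((56 , 3) ∷ (54 , 4) ∷ (50 , 1) ∷ (53 , 7) ∷ (55 , 2) ∷ (45 , 17) ∷ (44 , 6) ∷ (49 , 12) ∷
     (38 , 10) ∷ (37 , 19) ∷ (35 , 18) ∷ (27 , 20) ∷ (39 , 15) ∷ (30 , 25) ∷ (28 , 16) ∷
     (31 , 8) ∷ (23 , 22) ∷ (32 , 5) ∷ (29 , 11) ∷ (14 , 13) ∷ []) ∷
  certificate 15 27 54
    ([ 81 ] ∷ complements 81 16 27)
    ((35 , 46) ∷ (20 , 45) ∷ (14 , 50) ∷ (21 , 42) ∷ (2 , 59) ∷ (3 , 55) ∷ (11 , 48) ∷
     (16 , 41) ∷ (25 , 31) ∷ (10 , 39) ∷ (19 , 33) ∷ (22 , 29) ∷ (23 , 27) ∷ (7 , 40) ∷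
     (12 , 36) ∷ (8 , 32) ∷ (9 , 15) ∷ (1 , 38) ∷ (4 , 30) ∷ (6 , 26) ∷ (13 , 18) ∷ (5 , 17) ∷
     [])
    ((62 , 2) ∷ (60 , 3) ∷ (55 , 7) ∷ (53 , 4) ∷ (46 , 8) ∷ (44 , 14) ∷ (45 , 20) ∷ (36 , 13) ∷
     (33 , 28) ∷ (38 , 6) ∷ (35 , 21) ∷ (26 , 11) ∷ (42 , 1) ∷ (25 , 9) ∷ (37 , 15) ∷
     (43 , 17) ∷ (29 , 18) ∷ (41 , 10) ∷ (19 , 5) ∷ (16 , 12) ∷ (30 , 23) ∷ []) ∷
  certificate 12 27 54
    ([ 81 ] ∷ complements 81 13 27)
    ((32 , 49) ∷ (18 , 50) ∷ (1 , 65) ∷ (26 , 41) ∷ (3 , 60) ∷ (11 , 51) ∷ (19 , 45) ∷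
     (28 , 33) ∷ (12 , 46) ∷ (23 , 37) ∷ (6 , 53) ∷ (14 , 42) ∷ (17 , 36) ∷ (7 , 43) ∷
     (4 , 44) ∷ (21 , 30) ∷ (10 , 24) ∷ (5 , 34) ∷ (22 , 25) ∷ (15 , 20) ∷ (9 , 27) ∷
     (13 , 29) ∷ (2 , 8) ∷ [])
    ((65 , 1) ∷ (55 , 7) ∷ (57 , 11) ∷ (52 , 4) ∷ (46 , 2) ∷ (38 , 29) ∷ (44 , 20) ∷ (43 , 9) ∷
     (45 , 12) ∷ (33 , 28) ∷ (40 , 23) ∷ (37 , 22) ∷ (32 , 26) ∷ (18 , 17) ∷ (49 , 5) ∷
     (41 , 6) ∷ (16 , 15) ∷ (31 , 8) ∷ (24 , 14) ∷ (30 , 25) ∷ (13 , 3) ∷ (21 , 19) ∷ []) ∷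
  certificate 9 27 54
    ([ 81 ] ∷ complements 81 10 27)
    ((11 , 70) ∷ (7 , 64) ∷ (24 , 46) ∷ (4 , 65) ∷ (15 , 53) ∷ (33 , 34) ∷ (10 , 56) ∷
     (8 , 57) ∷ (2 , 60) ∷ (14 , 49) ∷ (26 , 35) ∷ (12 , 52) ∷ (17 , 38) ∷ (29 , 31) ∷
     (20 , 27) ∷ (3 , 54) ∷ (6 , 42) ∷ (19 , 25) ∷ (13 , 32) ∷ (18 , 22) ∷ (16 , 21) ∷
     (9 , 23) ∷ (5 , 28) ∷ (1 , 30) ∷ [])
    ((58 , 3) ∷ (59 , 8) ∷ (56 , 13) ∷ (51 , 15) ∷ (52 , 10) ∷ (50 , 9) ∷ (53 , 5) ∷ (42 , 1) ∷
     (36 , 19) ∷ (46 , 22) ∷ (41 , 30) ∷ (43 , 2) ∷ (38 , 6) ∷ (49 , 14) ∷ (34 , 7) ∷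
     (39 , 12) ∷ (25 , 11) ∷ (28 , 20) ∷ (23 , 17) ∷ (26 , 24) ∷ (29 , 18) ∷ (35 , 4) ∷
     (21 , 16) ∷ []) ∷
  certificate 6 10 71
    ([ 81 ] ∷ complements 81 7 10)
    ((24 , 57) ∷ (25 , 49) ∷ (2 , 70) ∷ (17 , 56) ∷ (20 , 50) ∷ (27 , 41) ∷ (8 , 61) ∷
     (29 , 38) ∷ (13 , 51) ∷ (14 , 52) ∷ (21 , 40) ∷ (28 , 35) ∷ (12 , 47) ∷ (22 , 34) ∷
     (5 , 60) ∷ (23 , 32) ∷ (6 , 42) ∷ (3 , 48) ∷ (10 , 39) ∷ (1 , 30) ∷ (7 , 15) ∷ (4 , 31) ∷
     (18 , 26) ∷ (9 , 33) ∷ (11 , 16) ∷ [])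
    ((62 , 7) ∷ (60 , 5) ∷ (57 , 17) ∷ (58 , 6) ∷ (53 , 18) ∷ (50 , 13) ∷ (54 , 12) ∷
     (36 , 26) ∷ (47 , 20) ∷ (46 , 9) ∷ (39 , 33) ∷ (41 , 32) ∷ (43 , 25) ∷ (52 , 2) ∷
     (38 , 15) ∷ (40 , 4) ∷ (37 , 21) ∷ (30 , 29) ∷ (23 , 14) ∷ (45 , 1) ∷ (28 , 8) ∷
     (34 , 11) ∷ (16 , 3) ∷ (24 , 19) ∷ []) ∷
  certificate 3 24 57
    ([ 81 ] ∷ complements 81 4 24)
    ((6 , 75) ∷ (4 , 73) ∷ (34 , 42) ∷ (25 , 49) ∷ (17 , 56) ∷ (33 , 37) ∷ (19 , 50) ∷
     (2 , 69) ∷ (7 , 58) ∷ (32 , 36) ∷ (23 , 43) ∷ (1 , 62) ∷ (8 , 59) ∷ (5 , 57) ∷ (21 , 31) ∷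
     (13 , 47) ∷ (29 , 30) ∷ (18 , 40) ∷ (9 , 44) ∷ (16 , 39) ∷ (10 , 22) ∷ (14 , 35) ∷
     (11 , 27) ∷ (3 , 12) ∷ (20 , 26) ∷ (15 , 28) ∷ [])
    ((75 , 1) ∷ (72 , 2) ∷ (64 , 13) ∷ (61 , 7) ∷ (54 , 12) ∷ (56 , 9) ∷ (51 , 4) ∷ (47 , 16) ∷
     (48 , 22) ∷ (45 , 3) ∷ (50 , 10) ∷ (42 , 19) ∷ (18 , 6) ∷ (39 , 33) ∷ (30 , 8) ∷
     (27 , 26) ∷ (44 , 23) ∷ (35 , 29) ∷ (36 , 5) ∷ (25 , 21) ∷ (41 , 11) ∷ (28 , 17) ∷
     (40 , 31) ∷ (34 , 20) ∷ (37 , 14) ∷ []) ∷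
  certificate 0 40 41
    ([ 81 ] ∷ complements 81 1 40)
    ((2 , 78) ∷ (6 , 71) ∷ (9 , 66) ∷ (11 , 63) ∷ (18 , 61) ∷ (5 , 62) ∷ (3 , 60) ∷ (4 , 55) ∷
     (12 , 58) ∷ (21 , 57) ∷ (16 , 56) ∷ (8 , 53) ∷ (36 , 45) ∷ (14 , 44) ∷ (13 , 51) ∷
     (17 , 29) ∷ (10 , 27) ∷ (20 , 24) ∷ (15 , 40) ∷ (7 , 38) ∷ (1 , 32) ∷ (19 , 50) ∷
     (25 , 41) ∷ (28 , 34) ∷ (23 , 37) ∷ (26 , 47) ∷ (22 , 43) ∷ [])
    ((76 , 3) ∷ (50 , 27) ∷ (42 , 38) ∷ (71 , 4) ∷ (48 , 28) ∷ (43 , 30) ∷ (56 , 18) ∷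
     (52 , 20) ∷ (35 , 32) ∷ (68 , 1) ∷ (57 , 7) ∷ (51 , 14) ∷ (54 , 16) ∷ (49 , 10) ∷
     (53 , 15) ∷ (31 , 23) ∷ (39 , 13) ∷ (47 , 2) ∷ (29 , 19) ∷ (36 , 6) ∷ (22 , 17) ∷
     (34 , 12) ∷ (26 , 5) ∷ (24 , 11) ∷ (25 , 8) ∷ (21 , 9) ∷ []) ∷
  certificate 0 49 75
    (⟨ 78 ∙ 82 ∙ 83 ⟩ ∷ [ 81 ] ∷ ⟨ 1 ∙ 80 ⟩ ∷ ⟨ 2 ∙ 79 ⟩ ∷ ⟨ 4 ∙ 77 ⟩ ∷ ⟨ 5 ∙ 76 ⟩ ∷ ⟨ 7 ∙ 74 ⟩ ∷ ⟨ 8 ∙ 73 ⟩ ∷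
     ⟨ 10 ∙ 71 ⟩ ∷ ⟨ 11 ∙ 70 ⟩ ∷ ⟨ 13 ∙ 68 ⟩ ∷ ⟨ 14 ∙ 67 ⟩ ∷ ⟨ 16 ∙ 65 ⟩ ∷ ⟨ 17 ∙ 64 ⟩ ∷ ⟨ 19 ∙ 62 ⟩ ∷
     ⟨ 22 ∙ 59 ⟩ ∷ ⟨ 25 ∙ 56 ⟩ ∷ ⟨ 28 ∙ 53 ⟩ ∷ ⟨ 31 ∙ 50 ⟩ ∷ ⟨ 34 ∙ 47 ⟩ ∷ ⟨ 37 ∙ 44 ⟩ ∷ ⟨ 40 ∙ 41 ⟩ ∷
     ⟨ 9 ∙ 72 ⟩ ∷ ⟨ 12 ∙ 69 ⟩ ∷ ⟨ 15 ∙ 66 ⟩ ∷ ⟨ 18 ∙ 63 ⟩ ∷ ⟨ 21 ∙ 60 ⟩ ∷ ⟨ 24 ∙ 57 ⟩ ∷ ⟨ 27 ∙ 54 ⟩ ∷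
     ⟨ 30 ∙ 51 ⟩ ∷ ⟨ 33 ∙ 48 ⟩ ∷ ⟨ 36 ∙ 45 ⟩ ∷ ⟨ 39 ∙ 42 ⟩ ∷ ⟨ 20 ∙ 23 ∙ 38 ⟩ ∷ ⟨ 26 ∙ 55 ⟩ ∷ ⟨ 29 ∙ 52 ⟩ ∷
     ⟨ 35 ∙ 46 ⟩ ∷ ⟨ 6 ∙ 32 ∙ 43 ⟩ ∷ [ 3 ] ∷ ⟨ 58 ∙ 61 ∙ 124 ⟩ ∷ [])
    ((59 , 65) ∷ (27 , 56) ∷ (18 , 64) ∷ (29 , 52) ∷ (24 , 54) ∷ (4 , 75) ∷ (31 , 46) ∷
     (28 , 48) ∷ (6 , 68) ∷ (17 , 55) ∷ (7 , 60) ∷ (34 , 37) ∷ (23 , 45) ∷ (26 , 40) ∷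
     (3 , 61) ∷ (30 , 32) ∷ (22 , 41) ∷ (21 , 39) ∷ (10 , 47) ∷ (12 , 36) ∷ (5 , 49) ∷
     (1 , 42) ∷ (11 , 25) ∷ (20 , 38) ∷ (13 , 33) ∷ (2 , 50) ∷ (8 , 19) ∷ (9 , 15) ∷ [])
    ((80 , 2) ∷ (73 , 4) ∷ (70 , 10) ∷ (69 , 7) ∷ (65 , 16) ∷ (61 , 5) ∷ (53 , 21) ∷ (42 , 41) ∷
     (50 , 29) ∷ (59 , 14) ∷ (56 , 22) ∷ (55 , 8) ∷ (44 , 28) ∷ (26 , 9) ∷ (34 , 33) ∷
     (37 , 32) ∷ (51 , 20) ∷ (25 , 18) ∷ (40 , 30) ∷ (38 , 19) ∷ (47 , 6) ∷ (15 , 1) ∷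
     (39 , 12) ∷ (45 , 17) ∷ (35 , 23) ∷ (31 , 13) ∷ (11 , 3) ∷ []) ∷
  certificate 5 72 77
    (⟨ 80 ∙ 81 ∙ 82 ⟩ ∷ ⟨ 76 ∙ 83 ∙ 84 ⟩ ∷ ⟨ 78 ∙ 79 ∙ 86 ⟩ ∷ ⟨ 6 ∙ 75 ⟩ ∷ ⟨ 7 ∙ 74 ⟩ ∷ ⟨ 8 ∙ 73 ⟩ ∷ ⟨ 10 ∙ 71 ⟩ ∷
     ⟨ 11 ∙ 70 ⟩ ∷ ⟨ 12 ∙ 69 ⟩ ∷ ⟨ 13 ∙ 68 ⟩ ∷ ⟨ 14 ∙ 67 ⟩ ∷ ⟨ 15 ∙ 66 ⟩ ∷ ⟨ 16 ∙ 65 ⟩ ∷ ⟨ 17 ∙ 64 ⟩ ∷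
     ⟨ 18 ∙ 63 ⟩ ∷ ⟨ 19 ∙ 62 ⟩ ∷ ⟨ 20 ∙ 61 ⟩ ∷ ⟨ 21 ∙ 60 ⟩ ∷ ⟨ 22 ∙ 59 ⟩ ∷ ⟨ 23 ∙ 58 ⟩ ∷ ⟨ 24 ∙ 57 ⟩ ∷
     ⟨ 25 ∙ 56 ⟩ ∷ ⟨ 26 ∙ 55 ⟩ ∷ ⟨ 27 ∙ 54 ⟩ ∷ ⟨ 28 ∙ 53 ⟩ ∷ ⟨ 29 ∙ 52 ⟩ ∷ ⟨ 30 ∙ 51 ⟩ ∷ ⟨ 31 ∙ 50 ⟩ ∷
     ⟨ 32 ∙ 49 ⟩ ∷ ⟨ 33 ∙ 48 ⟩ ∷ ⟨ 34 ∙ 47 ⟩ ∷ ⟨ 35 ∙ 46 ⟩ ∷ ⟨ 36 ∙ 45 ⟩ ∷ ⟨ 37 ∙ 44 ⟩ ∷ ⟨ 38 ∙ 43 ⟩ ∷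
     ⟨ 39 ∙ 42 ⟩ ∷ ⟨ 40 ∙ 41 ⟩ ∷ ⟨ 9 ∙ 85 ∙ 149 ⟩ ∷ [])
    ((64 , 85) ∷ (15 , 71) ∷ (30 , 54) ∷ (22 , 63) ∷ (38 , 45) ∷ (31 , 51) ∷ (21 , 59) ∷
     (12 , 69) ∷ (4 , 75) ∷ (25 , 53) ∷ (35 , 39) ∷ (19 , 57) ∷ (28 , 43) ∷ (5 , 68) ∷
     (3 , 65) ∷ (26 , 40) ∷ (2 , 61) ∷ (8 , 50) ∷ (24 , 37) ∷ (9 , 48) ∷ (13 , 42) ∷ (16 , 49) ∷
     (1 , 55) ∷ (17 , 32) ∷ (23 , 29) ∷ (14 , 18) ∷ (11 , 20) ∷ (6 , 27) ∷ (10 , 41) ∷ [])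
    ((75 , 11) ∷ (70 , 10) ∷ (67 , 15) ∷ (62 , 21) ∷ (69 , 12) ∷ (64 , 2) ∷ (60 , 17) ∷
     (59 , 20) ∷ (46 , 38) ∷ (53 , 9) ∷ (50 , 28) ∷ (48 , 8) ∷ (24 , 22) ∷ (40 , 36) ∷
     (44 , 29) ∷ (39 , 35) ∷ (47 , 25) ∷ (45 , 13) ∷ (34 , 18) ∷ (42 , 5) ∷ (37 , 23) ∷
     (41 , 26) ∷ (54 , 16) ∷ (19 , 14) ∷ (43 , 1) ∷ (30 , 6) ∷ (27 , 7) ∷ (4 , 3) ∷ []) ∷
  certificate 0 42 60
    (⟨ 69 ∙ 85 ∙ 89 ⟩ ∷ ⟨ 77 ∙ 80 ∙ 86 ⟩ ∷ ⟨ 78 ∙ 81 ∙ 84 ⟩ ∷ ⟨ 72 ∙ 83 ∙ 88 ⟩ ∷ ⟨ 74 ∙ 82 ∙ 87 ⟩ ∷ ⟨ 2 ∙ 79 ⟩ ∷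
     ⟨ 1 ∙ 4 ∙ 76 ⟩ ∷ ⟨ 6 ∙ 75 ⟩ ∷ ⟨ 8 ∙ 73 ⟩ ∷ ⟨ 13 ∙ 68 ⟩ ∷ ⟨ 14 ∙ 67 ⟩ ∷ ⟨ 3 ∙ 12 ∙ 66 ⟩ ∷ ⟨ 17 ∙ 64 ⟩ ∷
     ⟨ 18 ∙ 63 ⟩ ∷ ⟨ 19 ∙ 62 ⟩ ∷ ⟨ 7 ∙ 15 ∙ 59 ⟩ ∷ ⟨ 23 ∙ 58 ⟩ ∷ ⟨ 24 ∙ 57 ⟩ ∷ ⟨ 28 ∙ 53 ⟩ ∷ ⟨ 16 ∙ 65 ⟩ ∷
     ⟨ 20 ∙ 61 ⟩ ∷ ⟨ 25 ∙ 56 ⟩ ∷ ⟨ 29 ∙ 52 ⟩ ∷ ⟨ 34 ∙ 47 ⟩ ∷ ⟨ 26 ∙ 55 ⟩ ∷ ⟨ 27 ∙ 54 ⟩ ∷ ⟨ 30 ∙ 51 ⟩ ∷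
     ⟨ 35 ∙ 46 ⟩ ∷ ⟨ 33 ∙ 48 ⟩ ∷ ⟨ 38 ∙ 43 ⟩ ∷ ⟨ 36 ∙ 45 ⟩ ∷ ⟨ 37 ∙ 44 ⟩ ∷ ⟨ 5 ∙ 22 ⟩ ∷ ⟨ 31 ∙ 50 ⟩ ∷
     ⟨ 40 ∙ 41 ⟩ ∷ ⟨ 10 ∙ 32 ∙ 39 ⟩ ∷ ⟨ 11 ∙ 21 ∙ 49 ⟩ ∷ [ 9 ] ∷ ⟨ 70 ∙ 71 ∙ 102 ⟩ ∷ [])
    ((50 , 52) ∷ (12 , 77) ∷ (5 , 83) ∷ (26 , 61) ∷ (42 , 44) ∷ (13 , 72) ∷ (25 , 59) ∷
     (19 , 64) ∷ (2 , 80) ∷ (11 , 70) ∷ (29 , 51) ∷ (23 , 56) ∷ (18 , 60) ∷ (9 , 67) ∷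
     (1 , 74) ∷ (24 , 48) ∷ (3 , 68) ∷ (17 , 49) ∷ (8 , 57) ∷ (27 , 36) ∷ (6 , 58) ∷ (28 , 40) ∷
     (16 , 43) ∷ (10 , 47) ∷ (4 , 35) ∷ (21 , 33) ∷ (14 , 55) ∷ (15 , 46) ∷ (22 , 31) ∷
     (7 , 30) ∷ [])
    ((74 , 4) ∷ (77 , 9) ∷ (73 , 8) ∷ (67 , 6) ∷ (70 , 19) ∷ (56 , 20) ∷ (62 , 13) ∷ (58 , 26) ∷
     (48 , 40) ∷ (44 , 43) ∷ (51 , 34) ∷ (49 , 33) ∷ (41 , 38) ∷ (47 , 24) ∷ (46 , 23) ∷
     (35 , 28) ∷ (31 , 14) ∷ (52 , 1) ∷ (50 , 15) ∷ (55 , 7) ∷ (32 , 5) ∷ (22 , 12) ∷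
     (45 , 21) ∷ (30 , 2) ∷ (25 , 16) ∷ (36 , 18) ∷ (27 , 11) ∷ (17 , 3) ∷ (29 , 10) ∷ []) ∷
  certificate 0 42 90
    (⟨ 76 ∙ 79 ∙ 88 ⟩ ∷ ⟨ 80 ∙ 81 ∙ 82 ⟩ ∷ ⟨ 73 ∙ 78 ∙ 92 ⟩ ∷ ⟨ 70 ∙ 84 ∙ 89 ⟩ ∷ ⟨ 71 ∙ 85 ∙ 87 ⟩ ∷
     ⟨ 74 ∙ 83 ∙ 86 ⟩ ∷ ⟨ 75 ∙ 77 ∙ 91 ⟩ ∷ ⟨ 4 ∙ 8 ∙ 69 ⟩ ∷ ⟨ 6 ∙ 7 ∙ 68 ⟩ ∷ ⟨ 1 ∙ 13 ∙ 67 ⟩ ∷ ⟨ 5 ∙ 10 ∙ 66 ⟩ ∷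
     ⟨ 2 ∙ 14 ∙ 65 ⟩ ∷ ⟨ 17 ∙ 64 ⟩ ∷ ⟨ 18 ∙ 63 ⟩ ∷ ⟨ 19 ∙ 62 ⟩ ∷ ⟨ 22 ∙ 59 ⟩ ∷ ⟨ 20 ∙ 61 ⟩ ∷ ⟨ 21 ∙ 60 ⟩ ∷
     ⟨ 23 ∙ 58 ⟩ ∷ ⟨ 24 ∙ 57 ⟩ ∷ ⟨ 25 ∙ 56 ⟩ ∷ ⟨ 26 ∙ 55 ⟩ ∷ ⟨ 29 ∙ 52 ⟩ ∷ ⟨ 32 ∙ 49 ⟩ ∷ ⟨ 35 ∙ 46 ⟩ ∷
     ⟨ 28 ∙ 53 ⟩ ∷ ⟨ 30 ∙ 51 ⟩ ∷ ⟨ 33 ∙ 48 ⟩ ∷ ⟨ 31 ∙ 50 ⟩ ∷ ⟨ 34 ∙ 47 ⟩ ∷ ⟨ 37 ∙ 44 ⟩ ∷ ⟨ 40 ∙ 41 ⟩ ∷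
     ⟨ 36 ∙ 45 ⟩ ∷ ⟨ 38 ∙ 43 ⟩ ∷ [ 27 ] ∷ ⟨ 11 ∙ 16 ∙ 54 ⟩ ∷ ⟨ 12 ∙ 15 ⟩ ∷ [ 9 ] ∷ [ 3 ] ∷
     ⟨ 39 ∙ 72 ∙ 132 ⟩ ∷ [])
    ((53 , 79) ∷ (10 , 82) ∷ (25 , 66) ∷ (38 , 50) ∷ (24 , 65) ∷ (41 , 46) ∷ (8 , 78) ∷
     (42 , 43) ∷ (26 , 58) ∷ (3 , 77) ∷ (35 , 47) ∷ (34 , 44) ∷ (17 , 60) ∷ (7 , 67) ∷
     (2 , 71) ∷ (12 , 57) ∷ (21 , 45) ∷ (28 , 36) ∷ (19 , 37) ∷ (18 , 49) ∷ (30 , 40) ∷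
     (6 , 56) ∷ (29 , 32) ∷ (1 , 51) ∷ (4 , 13) ∷ (22 , 31) ∷ (14 , 33) ∷ (9 , 16) ∷ (5 , 27) ∷
     (20 , 23) ∷ (11 , 15) ∷ [])
    ((83 , 3) ∷ (81 , 7) ∷ (79 , 12) ∷ (76 , 8) ∷ (75 , 14) ∷ (71 , 4) ∷ (72 , 18) ∷ (65 , 27) ∷
     (58 , 16) ∷ (68 , 1) ∷ (60 , 2) ∷ (54 , 31) ∷ (63 , 5) ∷ (57 , 23) ∷ (59 , 28) ∷ (55 , 6) ∷
     (39 , 13) ∷ (38 , 10) ∷ (45 , 9) ∷ (49 , 21) ∷ (48 , 11) ∷ (24 , 15) ∷ (36 , 19) ∷
     (51 , 30) ∷ (40 , 33) ∷ (46 , 37) ∷ (44 , 20) ∷ (41 , 35) ∷ (34 , 29) ∷ (50 , 22) ∷ []) ∷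
  certificate 5 90 26
    ([ 27 ] ∷ ⟨ 7 ∙ 8 ∙ 12 ⟩ ∷ ⟨ 13 ∙ 14 ⟩ ∷ [ 9 ] ∷ ⟨ 54 ∙ 94 ∙ 95 ⟩ ∷ ⟨ 67 ∙ 87 ∙ 89 ⟩ ∷
     ⟨ 68 ∙ 83 ∙ 92 ⟩ ∷ ⟨ 69 ∙ 86 ∙ 88 ⟩ ∷ ⟨ 73 ∙ 77 ∙ 93 ⟩ ∷ ⟨ 74 ∙ 78 ∙ 91 ⟩ ∷ ⟨ 76 ∙ 82 ∙ 85 ⟩ ∷
     ⟨ 79 ∙ 80 ∙ 84 ⟩ ∷ [ 81 ] ∷ ⟨ 11 ∙ 70 ⟩ ∷ ⟨ 6 ∙ 75 ⟩ ∷ ⟨ 10 ∙ 71 ⟩ ∷ ⟨ 15 ∙ 66 ⟩ ∷ ⟨ 16 ∙ 65 ⟩ ∷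
     ⟨ 17 ∙ 64 ⟩ ∷ ⟨ 18 ∙ 63 ⟩ ∷ ⟨ 19 ∙ 62 ⟩ ∷ ⟨ 20 ∙ 61 ⟩ ∷ ⟨ 21 ∙ 60 ⟩ ∷ ⟨ 22 ∙ 59 ⟩ ∷ ⟨ 23 ∙ 58 ⟩ ∷
     ⟨ 24 ∙ 57 ⟩ ∷ ⟨ 25 ∙ 56 ⟩ ∷ ⟨ 28 ∙ 53 ⟩ ∷ ⟨ 29 ∙ 52 ⟩ ∷ ⟨ 30 ∙ 51 ⟩ ∷ ⟨ 31 ∙ 50 ⟩ ∷ ⟨ 32 ∙ 49 ⟩ ∷
     ⟨ 33 ∙ 48 ⟩ ∷ ⟨ 34 ∙ 47 ⟩ ∷ ⟨ 35 ∙ 46 ⟩ ∷ ⟨ 36 ∙ 45 ⟩ ∷ ⟨ 37 ∙ 44 ⟩ ∷ ⟨ 38 ∙ 43 ⟩ ∷ ⟨ 39 ∙ 42 ⟩ ∷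
     ⟨ 40 ∙ 41 ⟩ ∷ ⟨ 72 ∙ 55 ∙ 116 ⟩ ∷ [])
    ((43 , 73) ∷ (37 , 58) ∷ (13 , 81) ∷ (5 , 88) ∷ (42 , 50) ∷ (3 , 86) ∷ (19 , 69) ∷
     (28 , 59) ∷ (10 , 75) ∷ (35 , 49) ∷ (38 , 44) ∷ (26 , 57) ∷ (1 , 80) ∷ (21 , 65) ∷
     (6 , 74) ∷ (16 , 63) ∷ (24 , 53) ∷ (8 , 67) ∷ (14 , 60) ∷ (22 , 47) ∷ (17 , 45) ∷
     (32 , 36) ∷ (2 , 68) ∷ (9 , 51) ∷ (25 , 46) ∷ (29 , 34) ∷ (12 , 27) ∷ (15 , 30) ∷
     (20 , 23) ∷ (7 , 48) ∷ (4 , 40) ∷ (11 , 41) ∷ [])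
    ((91 , 3) ∷ (73 , 20) ∷ (76 , 15) ∷ (67 , 23) ∷ (72 , 4) ∷ (78 , 17) ∷ (65 , 1) ∷
     (61 , 10) ∷ (66 , 21) ∷ (57 , 25) ∷ (64 , 14) ∷ (58 , 31) ∷ (54 , 38) ∷ (56 , 5) ∷
     (59 , 13) ∷ (49 , 7) ∷ (47 , 8) ∷ (16 , 2) ∷ (22 , 9) ∷ (53 , 32) ∷ (27 , 6) ∷ (28 , 11) ∷
     (33 , 29) ∷ (42 , 37) ∷ (48 , 35) ∷ (50 , 34) ∷ (41 , 36) ∷ (30 , 24) ∷ (51 , 19) ∷
     (46 , 18) ∷ (40 , 12) ∷ []) ∷
  certificate 0 67 74
    (⟨ 70 ∙ 79 ∙ 94 ⟩ ∷ ⟨ 76 ∙ 80 ∙ 87 ⟩ ∷ ⟨ 68 ∙ 78 ∙ 97 ⟩ ∷ ⟨ 73 ∙ 77 ∙ 93 ⟩ ∷ ⟨ 71 ∙ 84 ∙ 88 ⟩ ∷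
     ⟨ 69 ∙ 83 ∙ 91 ⟩ ∷ ⟨ 64 ∙ 89 ∙ 90 ⟩ ∷ ⟨ 66 ∙ 82 ∙ 95 ⟩ ∷ ⟨ 65 ∙ 86 ∙ 92 ⟩ ∷ ⟨ 60 ∙ 85 ∙ 98 ⟩ ∷
     ⟨ 72 ∙ 75 ∙ 96 ⟩ ∷ ⟨ 6 ∙ 12 ∙ 63 ⟩ ∷ ⟨ 8 ∙ 11 ∙ 62 ⟩ ∷ ⟨ 20 ∙ 61 ⟩ ∷ ⟨ 22 ∙ 59 ⟩ ∷ ⟨ 10 ∙ 13 ∙ 58 ⟩ ∷
     ⟨ 1 ∙ 23 ∙ 57 ⟩ ∷ ⟨ 7 ∙ 18 ∙ 56 ⟩ ∷ ⟨ 26 ∙ 55 ⟩ ∷ ⟨ 2 ∙ 25 ∙ 54 ⟩ ∷ ⟨ 28 ∙ 53 ⟩ ∷ ⟨ 14 ∙ 15 ∙ 52 ⟩ ∷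
     ⟨ 30 ∙ 51 ⟩ ∷ ⟨ 31 ∙ 50 ⟩ ∷ ⟨ 34 ∙ 47 ⟩ ∷ ⟨ 32 ∙ 49 ⟩ ∷ ⟨ 35 ∙ 46 ⟩ ∷ ⟨ 37 ∙ 44 ⟩ ∷ ⟨ 39 ∙ 42 ⟩ ∷
     ⟨ 38 ∙ 43 ⟩ ∷ [ 27 ] ∷ [ 9 ] ∷ ⟨ 33 ∙ 48 ⟩ ∷ ⟨ 16 ∙ 29 ∙ 36 ⟩ ∷ ⟨ 17 ∙ 19 ∙ 45 ⟩ ∷ ⟨ 40 ∙ 41 ⟩ ∷
     ⟨ 3 ∙ 24 ⟩ ∷ ⟨ 4 ∙ 5 ⟩ ∷ ⟨ 81 ∙ 21 ∙ 141 ⟩ ∷ [])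
    ((69 , 72) ∷ (28 , 70) ∷ (11 , 85) ∷ (30 , 67) ∷ (39 , 56) ∷ (15 , 78) ∷ (38 , 54) ∷
     (10 , 81) ∷ (27 , 63) ∷ (31 , 58) ∷ (42 , 46) ∷ (1 , 86) ∷ (26 , 60) ∷ (23 , 59) ∷
     (36 , 48) ∷ (5 , 76) ∷ (29 , 51) ∷ (32 , 47) ∷ (17 , 61) ∷ (13 , 62) ∷ (33 , 40) ∷
     (22 , 50) ∷ (9 , 57) ∷ (24 , 34) ∷ (16 , 52) ∷ (7 , 53) ∷ (18 , 41) ∷ (14 , 49) ∷
     (20 , 25) ∷ (12 , 19) ∷ (2 , 45) ∷ (4 , 35) ∷ (3 , 8) ∷ [])
    ((94 , 2) ∷ (83 , 6) ∷ (85 , 13) ∷ (76 , 19) ∷ (77 , 10) ∷ (71 , 3) ∷ (70 , 12) ∷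
     (65 , 18) ∷ (53 , 44) ∷ (54 , 40) ∷ (56 , 36) ∷ (52 , 41) ∷ (61 , 30) ∷ (57 , 33) ∷
     (62 , 26) ∷ (69 , 4) ∷ (64 , 20) ∷ (50 , 29) ∷ (43 , 32) ∷ (55 , 25) ∷ (49 , 28) ∷
     (37 , 34) ∷ (38 , 27) ∷ (42 , 24) ∷ (48 , 16) ∷ (46 , 9) ∷ (35 , 8) ∷ (51 , 17) ∷
     (22 , 15) ∷ (23 , 21) ∷ (14 , 7) ∷ (5 , 1) ∷ []) ∷
  certificate 0 87 30
    ([ 27 ] ∷ ⟨ 1 ∙ 6 ∙ 20 ⟩ ∷ ⟨ 10 ∙ 17 ⟩ ∷ ⟨ 8 ∙ 19 ⟩ ∷ ⟨ 11 ∙ 16 ⟩ ∷ ⟨ 12 ∙ 15 ⟩ ∷ [ 3 ] ∷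
     ⟨ 13 ∙ 14 ⟩ ∷ [ 9 ] ∷ ⟨ 4 ∙ 5 ⟩ ∷ ⟨ 54 ∙ 92 ∙ 97 ⟩ ∷ ⟨ 61 ∙ 83 ∙ 99 ⟩ ∷ ⟨ 62 ∙ 86 ∙ 95 ⟩ ∷
     ⟨ 64 ∙ 85 ∙ 94 ⟩ ∷ ⟨ 67 ∙ 78 ∙ 98 ⟩ ∷ ⟨ 68 ∙ 82 ∙ 93 ⟩ ∷ ⟨ 72 ∙ 80 ∙ 91 ⟩ ∷ ⟨ 66 ∙ 77 ∙ 100 ⟩ ∷
     ⟨ 69 ∙ 73 ∙ 101 ⟩ ∷ ⟨ 65 ∙ 88 ∙ 90 ⟩ ∷ ⟨ 71 ∙ 76 ∙ 96 ⟩ ∷ ⟨ 70 ∙ 84 ∙ 89 ⟩ ∷ [ 81 ] ∷ ⟨ 2 ∙ 79 ⟩ ∷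
     ⟨ 7 ∙ 74 ⟩ ∷ ⟨ 18 ∙ 63 ⟩ ∷ ⟨ 21 ∙ 60 ⟩ ∷ ⟨ 22 ∙ 59 ⟩ ∷ ⟨ 23 ∙ 58 ⟩ ∷ ⟨ 24 ∙ 57 ⟩ ∷ ⟨ 25 ∙ 56 ⟩ ∷
     ⟨ 26 ∙ 55 ⟩ ∷ ⟨ 28 ∙ 53 ⟩ ∷ ⟨ 29 ∙ 52 ⟩ ∷ ⟨ 31 ∙ 50 ⟩ ∷ ⟨ 32 ∙ 49 ⟩ ∷ ⟨ 33 ∙ 48 ⟩ ∷ ⟨ 34 ∙ 47 ⟩ ∷
     ⟨ 35 ∙ 46 ⟩ ∷ ⟨ 36 ∙ 45 ⟩ ∷ ⟨ 37 ∙ 44 ⟩ ∷ ⟨ 38 ∙ 43 ⟩ ∷ ⟨ 39 ∙ 42 ⟩ ∷ ⟨ 40 ∙ 41 ⟩ ∷ ⟨ 75 ∙ 51 ∙ 117 ⟩ ∷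
     [])
    ((39 , 78) ∷ (2 , 99) ∷ (21 , 79) ∷ (29 , 69) ∷ (4 , 93) ∷ (37 , 59) ∷ (18 , 81) ∷
     (47 , 48) ∷ (8 , 84) ∷ (5 , 86) ∷ (19 , 74) ∷ (22 , 68) ∷ (36 , 53) ∷ (23 , 65) ∷
     (32 , 52) ∷ (10 , 76) ∷ (9 , 73) ∷ (17 , 62) ∷ (3 , 72) ∷ (11 , 67) ∷ (33 , 35) ∷
     (6 , 60) ∷ (26 , 50) ∷ (20 , 41) ∷ (31 , 34) ∷ (13 , 49) ∷ (15 , 44) ∷ (16 , 40) ∷
     (1 , 42) ∷ (12 , 30) ∷ (7 , 51) ∷ (27 , 43) ∷ (14 , 38) ∷ (24 , 25) ∷ [])
    ((94 , 6) ∷ (85 , 3) ∷ (80 , 7) ∷ (83 , 13) ∷ (77 , 17) ∷ (72 , 10) ∷ (81 , 8) ∷ (74 , 21) ∷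
     (67 , 24) ∷ (73 , 25) ∷ (60 , 37) ∷ (57 , 44) ∷ (63 , 14) ∷ (64 , 19) ∷ (48 , 18) ∷
     (71 , 4) ∷ (51 , 29) ∷ (46 , 9) ∷ (53 , 32) ∷ (50 , 40) ∷ (47 , 45) ∷ (54 , 16) ∷
     (69 , 2) ∷ (55 , 1) ∷ (23 , 5) ∷ (31 , 26) ∷ (38 , 20) ∷ (39 , 15) ∷ (41 , 22) ∷
     (36 , 28) ∷ (35 , 11) ∷ (33 , 12) ∷ (34 , 27) ∷ []) ∷
  certificate 3 39 80
    (⟨ 67 ∙ 79 ∙ 97 ⟩ ∷ ⟨ 71 ∙ 77 ∙ 95 ⟩ ∷ ⟨ 69 ∙ 78 ∙ 96 ⟩ ∷ ⟨ 4 ∙ 5 ∙ 72 ⟩ ∷ ⟨ 75 ∙ 76 ∙ 92 ⟩ ∷ ⟨ 61 ∙ 83 ∙ 99 ⟩ ∷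
     ⟨ 57 ∙ 82 ∙ 104 ⟩ ∷ ⟨ 68 ∙ 74 ∙ 101 ⟩ ∷ ⟨ 70 ∙ 84 ∙ 89 ⟩ ∷ [ 81 ] ∷ ⟨ 64 ∙ 88 ∙ 91 ⟩ ∷ ⟨ 59 ∙ 86 ∙ 98 ⟩ ∷
     ⟨ 66 ∙ 87 ∙ 90 ⟩ ∷ ⟨ 56 ∙ 93 ∙ 94 ⟩ ∷ ⟨ 38 ∙ 102 ∙ 103 ⟩ ∷ ⟨ 58 ∙ 85 ∙ 100 ⟩ ∷ ⟨ 7 ∙ 9 ∙ 65 ⟩ ∷
     ⟨ 8 ∙ 10 ∙ 63 ⟩ ∷ ⟨ 6 ∙ 13 ∙ 62 ⟩ ∷ ⟨ 21 ∙ 60 ⟩ ∷ ⟨ 26 ∙ 55 ⟩ ∷ ⟨ 11 ∙ 16 ∙ 54 ⟩ ∷ ⟨ 28 ∙ 53 ⟩ ∷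
     ⟨ 29 ∙ 52 ⟩ ∷ ⟨ 31 ∙ 50 ⟩ ∷ ⟨ 14 ∙ 18 ∙ 49 ⟩ ∷ ⟨ 33 ∙ 48 ⟩ ∷ ⟨ 40 ∙ 41 ⟩ ∷ ⟨ 12 ∙ 22 ∙ 47 ⟩ ∷
     ⟨ 15 ∙ 23 ∙ 43 ⟩ ∷ ⟨ 35 ∙ 46 ⟩ ∷ ⟨ 24 ∙ 25 ∙ 32 ⟩ ∷ ⟨ 17 ∙ 30 ∙ 34 ⟩ ∷ ⟨ 36 ∙ 45 ⟩ ∷ ⟨ 37 ∙ 44 ⟩ ∷
     ⟨ 19 ∙ 20 ∙ 42 ⟩ ∷ [ 27 ] ∷ ⟨ 73 ∙ 51 ∙ 119 ⟩ ∷ [])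
    ((50 , 69) ∷ (4 , 100) ∷ (48 , 55) ∷ (8 , 94) ∷ (20 , 79) ∷ (18 , 82) ∷ (34 , 64) ∷
     (3 , 93) ∷ (41 , 54) ∷ (16 , 78) ∷ (5 , 88) ∷ (10 , 87) ∷ (28 , 62) ∷ (38 , 53) ∷
     (21 , 68) ∷ (19 , 67) ∷ (39 , 46) ∷ (36 , 43) ∷ (11 , 76) ∷ (15 , 61) ∷ (31 , 47) ∷
     (9 , 66) ∷ (40 , 42) ∷ (22 , 45) ∷ (25 , 44) ∷ (14 , 57) ∷ (33 , 37) ∷ (7 , 58) ∷
     (23 , 29) ∷ (12 , 30) ∷ (17 , 27) ∷ (24 , 35) ∷ (1 , 26) ∷ (6 , 49) ∷ (2 , 32) ∷ [])
    ((101 , 3) ∷ (92 , 7) ∷ (88 , 9) ∷ (81 , 11) ∷ (84 , 5) ∷ (83 , 19) ∷ (77 , 21) ∷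
     (74 , 17) ∷ (68 , 28) ∷ (73 , 8) ∷ (66 , 4) ∷ (63 , 20) ∷ (56 , 47) ∷ (72 , 29) ∷
     (60 , 14) ∷ (64 , 13) ∷ (43 , 22) ∷ (12 , 1) ∷ (51 , 24) ∷ (62 , 23) ∷ (61 , 25) ∷
     (48 , 15) ∷ (58 , 2) ∷ (46 , 6) ∷ (40 , 32) ∷ (38 , 18) ∷ (54 , 41) ∷ (35 , 16) ∷
     (53 , 31) ∷ (57 , 33) ∷ (50 , 30) ∷ (37 , 36) ∷ (45 , 26) ∷ (49 , 10) ∷ []) ∷
  certificate 0 11 107
    (⟨ 74 ∙ 79 ∙ 90 ⟩ ∷ ⟨ 66 ∙ 77 ∙ 100 ⟩ ∷ ⟨ 67 ∙ 75 ∙ 101 ⟩ ∷ ⟨ 58 ∙ 83 ∙ 102 ⟩ ∷ ⟨ 70 ∙ 82 ∙ 91 ⟩ ∷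
     ⟨ 56 ∙ 81 ∙ 106 ⟩ ∷ ⟨ 73 ∙ 84 ∙ 86 ⟩ ∷ ⟨ 50 ∙ 88 ∙ 105 ⟩ ∷ ⟨ 69 ∙ 85 ∙ 89 ⟩ ∷ ⟨ 72 ∙ 78 ∙ 93 ⟩ ∷
     ⟨ 52 ∙ 94 ∙ 97 ⟩ ∷ ⟨ 44 ∙ 95 ∙ 104 ⟩ ∷ ⟨ 46 ∙ 98 ∙ 99 ⟩ ∷ ⟨ 60 ∙ 87 ∙ 96 ⟩ ∷ ⟨ 48 ∙ 92 ∙ 103 ⟩ ∷ ⟨ 1 ∙ 80 ⟩ ∷
     ⟨ 5 ∙ 76 ⟩ ∷ ⟨ 3 ∙ 7 ∙ 71 ⟩ ∷ ⟨ 4 ∙ 9 ∙ 68 ⟩ ∷ ⟨ 2 ∙ 15 ∙ 64 ⟩ ∷ ⟨ 16 ∙ 65 ⟩ ∷ ⟨ 20 ∙ 61 ⟩ ∷ ⟨ 10 ∙ 12 ∙ 59 ⟩ ∷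
     ⟨ 24 ∙ 57 ⟩ ∷ ⟨ 8 ∙ 18 ∙ 55 ⟩ ∷ ⟨ 28 ∙ 53 ⟩ ∷ ⟨ 30 ∙ 51 ⟩ ∷ ⟨ 34 ∙ 47 ⟩ ∷ ⟨ 6 ∙ 21 ∙ 54 ⟩ ∷ ⟨ 32 ∙ 49 ⟩ ∷
     ⟨ 38 ∙ 43 ⟩ ∷ ⟨ 40 ∙ 41 ⟩ ∷ ⟨ 13 ∙ 31 ∙ 37 ⟩ ∷ ⟨ 17 ∙ 29 ∙ 35 ⟩ ∷ [ 27 ] ∷ ⟨ 14 ∙ 22 ∙ 45 ⟩ ∷
     ⟨ 39 ∙ 42 ⟩ ∷ ⟨ 19 ∙ 26 ∙ 36 ⟩ ∷ ⟨ 23 ∙ 25 ∙ 33 ⟩ ∷ ⟨ 63 ∙ 62 ∙ 118 ⟩ ∷ [])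
    ((11 , 107) ∷ (48 , 58) ∷ (50 , 55) ∷ (26 , 78) ∷ (4 , 98) ∷ (27 , 76) ∷ (41 , 60) ∷
     (17 , 83) ∷ (42 , 56) ∷ (30 , 65) ∷ (5 , 89) ∷ (16 , 81) ∷ (31 , 62) ∷ (21 , 69) ∷
     (18 , 74) ∷ (9 , 79) ∷ (3 , 86) ∷ (40 , 44) ∷ (7 , 80) ∷ (32 , 53) ∷ (15 , 64) ∷ (1 , 77) ∷
     (29 , 54) ∷ (38 , 43) ∷ (6 , 68) ∷ (34 , 46) ∷ (25 , 45) ∷ (19 , 49) ∷ (23 , 28) ∷
     (12 , 13) ∷ (24 , 36) ∷ (22 , 51) ∷ (8 , 63) ∷ (20 , 37) ∷ (14 , 39) ∷ (2 , 33) ∷ [])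
    ((99 , 1) ∷ (96 , 8) ∷ (91 , 14) ∷ (82 , 6) ∷ (86 , 16) ∷ (76 , 15) ∷ (77 , 10) ∷
     (66 , 18) ∷ (75 , 31) ∷ (72 , 21) ∷ (64 , 33) ∷ (67 , 36) ∷ (62 , 34) ∷ (56 , 38) ∷
     (52 , 49) ∷ (54 , 45) ∷ (58 , 37) ∷ (48 , 44) ∷ (47 , 43) ∷ (69 , 2) ∷ (41 , 32) ∷
     (63 , 12) ∷ (40 , 27) ∷ (65 , 17) ∷ (24 , 23) ∷ (39 , 13) ∷ (46 , 20) ∷ (61 , 9) ∷
     (55 , 4) ∷ (29 , 28) ∷ (59 , 26) ∷ (42 , 19) ∷ (50 , 22) ∷ (30 , 5) ∷ (7 , 3) ∷ []) ∷
  certificate 2 63 68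
    (⟨ 56 ∙ 79 ∙ 108 ⟩ ∷ ⟨ 75 ∙ 77 ∙ 91 ⟩ ∷ ⟨ 74 ∙ 80 ∙ 89 ⟩ ∷ ⟨ 73 ∙ 82 ∙ 88 ⟩ ∷ ⟨ 69 ∙ 71 ∙ 103 ⟩ ∷
     ⟨ 55 ∙ 78 ∙ 110 ⟩ ∷ ⟨ 53 ∙ 81 ∙ 109 ⟩ ∷ ⟨ 66 ∙ 76 ∙ 101 ⟩ ∷ ⟨ 62 ∙ 83 ∙ 98 ⟩ ∷ ⟨ 65 ∙ 85 ∙ 93 ⟩ ∷
     ⟨ 70 ∙ 86 ∙ 87 ⟩ ∷ ⟨ 57 ∙ 84 ∙ 102 ⟩ ∷ ⟨ 47 ∙ 96 ∙ 100 ⟩ ∷ ⟨ 45 ∙ 92 ∙ 106 ⟩ ∷ ⟨ 50 ∙ 94 ∙ 99 ⟩ ∷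
     ⟨ 43 ∙ 95 ∙ 105 ⟩ ∷ ⟨ 46 ∙ 90 ∙ 107 ⟩ ∷ ⟨ 67 ∙ 72 ∙ 104 ⟩ ∷ ⟨ 17 ∙ 64 ⟩ ∷ ⟨ 9 ∙ 11 ∙ 61 ⟩ ∷ ⟨ 5 ∙ 16 ∙ 60 ⟩ ∷
     ⟨ 3 ∙ 20 ∙ 58 ⟩ ∷ ⟨ 8 ∙ 14 ∙ 59 ⟩ ∷ ⟨ 4 ∙ 23 ∙ 54 ⟩ ∷ ⟨ 29 ∙ 52 ⟩ ∷ ⟨ 30 ∙ 51 ⟩ ∷ ⟨ 10 ∙ 22 ∙ 49 ⟩ ∷
     ⟨ 7 ∙ 34 ∙ 40 ⟩ ∷ ⟨ 6 ∙ 36 ∙ 39 ⟩ ∷ ⟨ 33 ∙ 48 ⟩ ∷ ⟨ 12 ∙ 28 ∙ 41 ⟩ ∷ ⟨ 18 ∙ 31 ∙ 32 ⟩ ∷ ⟨ 21 ∙ 25 ∙ 35 ⟩ ∷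
     [ 27 ] ∷ ⟨ 19 ∙ 24 ∙ 38 ⟩ ∷ ⟨ 37 ∙ 44 ⟩ ∷ ⟨ 13 ∙ 26 ∙ 42 ⟩ ∷ ⟨ 97 ∙ 15 ∙ 131 ⟩ ∷ [])
    ((32 , 99) ∷ (24 , 86) ∷ (48 , 61) ∷ (31 , 77) ∷ (52 , 55) ∷ (13 , 93) ∷ (1 , 104) ∷
     (5 , 97) ∷ (2 , 101) ∷ (9 , 95) ∷ (35 , 66) ∷ (44 , 56) ∷ (28 , 69) ∷ (14 , 82) ∷
     (17 , 75) ∷ (7 , 88) ∷ (23 , 70) ∷ (40 , 41) ∷ (19 , 71) ∷ (29 , 53) ∷ (36 , 38) ∷
     (27 , 62) ∷ (26 , 57) ∷ (8 , 76) ∷ (15 , 65) ∷ (21 , 54) ∷ (25 , 47) ∷ (10 , 49) ∷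
     (11 , 59) ∷ (4 , 67) ∷ (20 , 42) ∷ (3 , 37) ∷ (16 , 33) ∷ (12 , 43) ∷ (6 , 50) ∷
     (18 , 39) ∷ (22 , 30) ∷ [])
    ((98 , 7) ∷ (99 , 10) ∷ (94 , 6) ∷ (85 , 9) ∷ (91 , 16) ∷ (86 , 24) ∷ (87 , 5) ∷ (78 , 25) ∷
     (77 , 4) ∷ (73 , 14) ∷ (88 , 2) ∷ (79 , 23) ∷ (66 , 8) ∷ (76 , 32) ∷ (64 , 19) ∷
     (65 , 20) ∷ (60 , 36) ∷ (67 , 39) ∷ (69 , 3) ∷ (54 , 26) ∷ (58 , 15) ∷ (53 , 11) ∷
     (45 , 44) ∷ (28 , 17) ∷ (33 , 13) ∷ (43 , 35) ∷ (51 , 47) ∷ (22 , 12) ∷ (46 , 38) ∷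
     (34 , 29) ∷ (42 , 18) ∷ (61 , 30) ∷ (50 , 1) ∷ (48 , 31) ∷ (41 , 27) ∷ (37 , 21) ∷ []) ∷
  certificate 3 39 86
    (⟨ 75 ∙ 79 ∙ 89 ⟩ ∷ ⟨ 69 ∙ 71 ∙ 103 ⟩ ∷ ⟨ 14 ∙ 67 ⟩ ∷ ⟨ 64 ∙ 66 ∙ 113 ⟩ ∷ ⟨ 58 ∙ 80 ∙ 105 ⟩ ∷
     ⟨ 61 ∙ 78 ∙ 104 ⟩ ∷ ⟨ 55 ∙ 77 ∙ 111 ⟩ ∷ ⟨ 73 ∙ 76 ∙ 94 ⟩ ∷ ⟨ 62 ∙ 82 ∙ 99 ⟩ ∷ ⟨ 63 ∙ 74 ∙ 106 ⟩ ∷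
     ⟨ 68 ∙ 84 ∙ 91 ⟩ ∷ ⟨ 70 ∙ 72 ∙ 101 ⟩ ∷ ⟨ 52 ∙ 83 ∙ 108 ⟩ ∷ ⟨ 48 ∙ 85 ∙ 110 ⟩ ∷ ⟨ 51 ∙ 95 ∙ 97 ⟩ ∷
     ⟨ 49 ∙ 92 ∙ 102 ⟩ ∷ ⟨ 60 ∙ 87 ∙ 96 ⟩ ∷ ⟨ 50 ∙ 93 ∙ 100 ⟩ ∷ ⟨ 27 ∙ 107 ∙ 109 ⟩ ∷ ⟨ 57 ∙ 88 ∙ 98 ⟩ ∷
     ⟨ 41 ∙ 90 ∙ 112 ⟩ ∷ ⟨ 16 ∙ 65 ⟩ ∷ ⟨ 4 ∙ 18 ∙ 59 ⟩ ∷ ⟨ 8 ∙ 17 ∙ 56 ⟩ ∷ ⟨ 6 ∙ 21 ∙ 54 ⟩ ∷ ⟨ 28 ∙ 53 ⟩ ∷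
     ⟨ 24 ∙ 26 ∙ 31 ⟩ ∷ ⟨ 10 ∙ 33 ∙ 38 ⟩ ∷ ⟨ 13 ∙ 25 ∙ 43 ⟩ ∷ ⟨ 36 ∙ 45 ⟩ ∷ ⟨ 35 ∙ 46 ⟩ ∷ ⟨ 11 ∙ 23 ∙ 47 ⟩ ∷
     ⟨ 12 ∙ 15 ⟩ ∷ ⟨ 20 ∙ 29 ∙ 32 ⟩ ∷ ⟨ 7 ∙ 30 ∙ 44 ⟩ ∷ ⟨ 5 ∙ 34 ∙ 42 ⟩ ∷ ⟨ 19 ∙ 22 ∙ 40 ⟩ ∷ [ 9 ] ∷
     ⟨ 81 ∙ 37 ∙ 125 ⟩ ∷ [])
    ((55 , 70) ∷ (1 , 112) ∷ (18 , 94) ∷ (9 , 102) ∷ (32 , 78) ∷ (21 , 88) ∷ (47 , 60) ∷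
     (22 , 84) ∷ (42 , 62) ∷ (12 , 93) ∷ (6 , 95) ∷ (37 , 66) ∷ (33 , 65) ∷ (13 , 87) ∷
     (2 , 97) ∷ (38 , 58) ∷ (43 , 51) ∷ (10 , 82) ∷ (34 , 59) ∷ (17 , 72) ∷ (15 , 76) ∷
     (25 , 63) ∷ (26 , 57) ∷ (7 , 75) ∷ (20 , 61) ∷ (31 , 54) ∷ (39 , 45) ∷ (24 , 56) ∷
     (30 , 40) ∷ (5 , 73) ∷ (28 , 49) ∷ (16 , 53) ∷ (8 , 52) ∷ (11 , 23) ∷ (14 , 50) ∷
     (3 , 41) ∷ (4 , 29) ∷ (27 , 36) ∷ [])
    ((108 , 2) ∷ (102 , 4) ∷ (97 , 10) ∷ (95 , 6) ∷ (90 , 15) ∷ (87 , 26) ∷ (79 , 20) ∷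
     (74 , 5) ∷ (76 , 32) ∷ (72 , 31) ∷ (65 , 18) ∷ (59 , 50) ∷ (62 , 49) ∷ (71 , 9) ∷
     (67 , 37) ∷ (54 , 46) ∷ (66 , 11) ∷ (53 , 45) ∷ (75 , 21) ∷ (47 , 42) ∷ (52 , 38) ∷
     (22 , 13) ∷ (55 , 14) ∷ (48 , 19) ∷ (58 , 27) ∷ (28 , 16) ∷ (43 , 3) ∷ (73 , 1) ∷
     (12 , 7) ∷ (51 , 17) ∷ (36 , 35) ∷ (68 , 24) ∷ (61 , 30) ∷ (57 , 29) ∷ (56 , 25) ∷
     (41 , 23) ∷ (40 , 8) ∷ []) ∷
  certificate 0 51 75
    (⟨ 69 ∙ 77 ∙ 97 ⟩ ∷ ⟨ 47 ∙ 80 ∙ 116 ⟩ ∷ ⟨ 70 ∙ 82 ∙ 91 ⟩ ∷ ⟨ 58 ∙ 78 ∙ 107 ⟩ ∷ ⟨ 59 ∙ 81 ∙ 103 ⟩ ∷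
     ⟨ 7 ∙ 74 ⟩ ∷ ⟨ 57 ∙ 73 ∙ 113 ⟩ ∷ ⟨ 68 ∙ 76 ∙ 99 ⟩ ∷ ⟨ 62 ∙ 71 ∙ 110 ⟩ ∷ ⟨ 60 ∙ 72 ∙ 111 ⟩ ∷
     ⟨ 65 ∙ 83 ∙ 95 ⟩ ∷ ⟨ 66 ∙ 84 ∙ 93 ⟩ ∷ ⟨ 54 ∙ 85 ∙ 104 ⟩ ∷ ⟨ 42 ∙ 87 ∙ 114 ⟩ ∷ ⟨ 53 ∙ 89 ∙ 101 ⟩ ∷
     ⟨ 44 ∙ 90 ∙ 109 ⟩ ∷ ⟨ 52 ∙ 86 ∙ 105 ⟩ ∷ ⟨ 37 ∙ 94 ∙ 112 ⟩ ∷ ⟨ 49 ∙ 88 ∙ 106 ⟩ ∷ ⟨ 45 ∙ 98 ∙ 100 ⟩ ∷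
     ⟨ 33 ∙ 102 ∙ 108 ⟩ ∷ ⟨ 55 ∙ 92 ∙ 96 ⟩ ∷ ⟨ 61 ∙ 67 ∙ 115 ⟩ ∷ ⟨ 1 ∙ 16 ∙ 64 ⟩ ∷ ⟨ 18 ∙ 63 ⟩ ∷
     ⟨ 12 ∙ 13 ∙ 56 ⟩ ∷ ⟨ 11 ∙ 22 ∙ 48 ⟩ ∷ ⟨ 10 ∙ 32 ∙ 39 ⟩ ∷ ⟨ 3 ∙ 28 ∙ 50 ⟩ ∷ ⟨ 25 ∙ 27 ∙ 29 ⟩ ∷
     ⟨ 15 ∙ 23 ∙ 43 ⟩ ∷ ⟨ 21 ∙ 26 ∙ 34 ⟩ ∷ ⟨ 17 ∙ 24 ∙ 40 ⟩ ∷ ⟨ 2 ∙ 6 ∙ 19 ⟩ ∷ ⟨ 20 ∙ 30 ∙ 31 ⟩ ∷ ⟨ 35 ∙ 46 ⟩ ∷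
     ⟨ 4 ∙ 36 ∙ 41 ⟩ ∷ ⟨ 5 ∙ 8 ∙ 14 ⟩ ∷ [ 9 ] ∷ ⟨ 38 ∙ 79 ∙ 126 ⟩ ∷ [])
    ((58 , 68) ∷ (8 , 107) ∷ (1 , 100) ∷ (3 , 97) ∷ (16 , 92) ∷ (17 , 90) ∷ (9 , 88) ∷
     (21 , 89) ∷ (35 , 78) ∷ (12 , 81) ∷ (27 , 87) ∷ (33 , 83) ∷ (26 , 77) ∷ (48 , 64) ∷
     (23 , 72) ∷ (10 , 71) ∷ (7 , 67) ∷ (20 , 69) ∷ (25 , 79) ∷ (19 , 75) ∷ (11 , 65) ∷
     (40 , 62) ∷ (5 , 22) ∷ (29 , 70) ∷ (6 , 47) ∷ (4 , 15) ∷ (31 , 34) ∷ (14 , 41) ∷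
     (36 , 51) ∷ (44 , 46) ∷ (32 , 38) ∷ (43 , 45) ∷ (50 , 56) ∷ (37 , 61) ∷ (39 , 53) ∷
     (28 , 63) ∷ (13 , 49) ∷ (2 , 24) ∷ (18 , 66) ∷ [])
    ((60 , 56) ∷ (79 , 36) ∷ (86 , 28) ∷ (111 , 2) ∷ (83 , 29) ∷ (109 , 1) ∷ (59 , 50) ∷
     (71 , 37) ∷ (73 , 33) ∷ (85 , 20) ∷ (105 , 6) ∷ (96 , 8) ∷ (54 , 49) ∷ (64 , 38) ∷
     (66 , 35) ∷ (58 , 40) ∷ (69 , 30) ∷ (82 , 14) ∷ (61 , 34) ∷ (72 , 22) ∷ (57 , 25) ∷
     (47 , 46) ∷ (52 , 39) ∷ (68 , 5) ∷ (45 , 41) ∷ (78 , 7) ∷ (80 , 4) ∷ (67 , 9) ∷ (77 , 3) ∷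
     (63 , 11) ∷ (31 , 21) ∷ (42 , 15) ∷ (43 , 16) ∷ (32 , 23) ∷ (48 , 12) ∷ (44 , 10) ∷
     (24 , 18) ∷ (17 , 13) ∷ []) ∷
  certificate 0 4 116
    (⟨ 70 ∙ 79 ∙ 94 ⟩ ∷ ⟨ 65 ∙ 77 ∙ 101 ⟩ ∷ ⟨ 75 ∙ 76 ∙ 92 ⟩ ∷ ⟨ 5 ∙ 7 ∙ 69 ⟩ ∷ ⟨ 13 ∙ 68 ⟩ ∷ ⟨ 67 ∙ 72 ∙ 104 ⟩ ∷
     ⟨ 58 ∙ 66 ∙ 119 ⟩ ∷ ⟨ 63 ∙ 81 ∙ 99 ⟩ ∷ ⟨ 54 ∙ 80 ∙ 109 ⟩ ∷ ⟨ 74 ∙ 84 ∙ 85 ⟩ ∷ ⟨ 59 ∙ 71 ∙ 113 ⟩ ∷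
     ⟨ 52 ∙ 73 ∙ 118 ⟩ ∷ ⟨ 49 ∙ 83 ∙ 111 ⟩ ∷ ⟨ 56 ∙ 82 ∙ 105 ⟩ ∷ ⟨ 61 ∙ 87 ∙ 95 ⟩ ∷ ⟨ 62 ∙ 90 ∙ 91 ⟩ ∷
     ⟨ 17 ∙ 64 ⟩ ∷ ⟨ 21 ∙ 60 ⟩ ∷ ⟨ 43 ∙ 86 ∙ 114 ⟩ ∷ ⟨ 47 ∙ 88 ∙ 108 ⟩ ∷ ⟨ 48 ∙ 89 ∙ 106 ⟩ ∷ ⟨ 30 ∙ 98 ∙ 115 ⟩ ∷
     ⟨ 35 ∙ 96 ∙ 112 ⟩ ∷ ⟨ 23 ∙ 103 ∙ 117 ⟩ ∷ ⟨ 53 ∙ 93 ∙ 97 ⟩ ∷ ⟨ 26 ∙ 107 ∙ 110 ⟩ ∷ ⟨ 41 ∙ 100 ∙ 102 ⟩ ∷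
     ⟨ 10 ∙ 14 ∙ 57 ⟩ ∷ ⟨ 1 ∙ 25 ∙ 55 ⟩ ∷ ⟨ 8 ∙ 22 ∙ 51 ⟩ ∷ ⟨ 12 ∙ 29 ∙ 40 ⟩ ∷ ⟨ 15 ∙ 16 ∙ 50 ⟩ ∷ ⟨ 2 ∙ 33 ∙ 46 ⟩ ∷
     ⟨ 18 ∙ 31 ∙ 32 ⟩ ∷ ⟨ 6 ∙ 36 ∙ 39 ⟩ ∷ ⟨ 11 ∙ 28 ∙ 42 ⟩ ∷ ⟨ 19 ∙ 24 ∙ 38 ⟩ ∷ ⟨ 37 ∙ 44 ⟩ ∷ ⟨ 20 ∙ 27 ∙ 34 ⟩ ∷
     [ 9 ] ∷ [ 3 ] ∷ ⟨ 45 ∙ 78 ∙ 120 ⟩ ∷ [])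
    ((14 , 105) ∷ (6 , 107) ∷ (8 , 106) ∷ (9 , 101) ∷ (2 , 94) ∷ (25 , 93) ∷ (20 , 92) ∷
     (22 , 95) ∷ (13 , 85) ∷ (21 , 81) ∷ (30 , 90) ∷ (5 , 76) ∷ (17 , 82) ∷ (18 , 88) ∷
     (32 , 73) ∷ (40 , 71) ∷ (26 , 77) ∷ (19 , 75) ∷ (34 , 66) ∷ (7 , 84) ∷ (47 , 68) ∷
     (46 , 61) ∷ (4 , 62) ∷ (1 , 74) ∷ (43 , 65) ∷ (38 , 55) ∷ (37 , 51) ∷ (12 , 28) ∷
     (23 , 59) ∷ (42 , 45) ∷ (3 , 54) ∷ (29 , 44) ∷ (15 , 39) ∷ (35 , 36) ∷ (11 , 56) ∷
     (48 , 53) ∷ (31 , 33) ∷ (27 , 58) ∷ (16 , 52) ∷ (10 , 41) ∷ [])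
    ((97 , 22) ∷ (109 , 9) ∷ (79 , 38) ∷ (92 , 24) ∷ (70 , 45) ∷ (84 , 30) ∷ (69 , 43) ∷
     (74 , 37) ∷ (104 , 6) ∷ (58 , 55) ∷ (90 , 19) ∷ (95 , 13) ∷ (77 , 25) ∷ (89 , 15) ∷
     (65 , 35) ∷ (83 , 14) ∷ (59 , 44) ∷ (80 , 11) ∷ (86 , 12) ∷ (72 , 27) ∷ (76 , 10) ∷
     (53 , 34) ∷ (50 , 29) ∷ (61 , 28) ∷ (78 , 5) ∷ (63 , 33) ∷ (49 , 31) ∷ (47 , 20) ∷
     (62 , 7) ∷ (42 , 36) ∷ (60 , 3) ∷ (39 , 21) ∷ (32 , 17) ∷ (23 , 1) ∷ (41 , 16) ∷ (48 , 2) ∷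
     (56 , 8) ∷ (46 , 26) ∷ (52 , 18) ∷ []) ∷
  []

-- Checking the table for each power of 3.

certificateAt : ℕ → Certificate
certificateAt = lookup certificates
  where
  lookup : List Certificate → ℕ → Certificate
  -- A default that is never reached: the table has 40 entries, and only indices below 40 are looked
  -- up.
  lookup []       _       = certificate 0 0 0 [] [] []
  lookup (c ∷ _)  zero    = c
  lookup (_ ∷ cs) (suc q) = lookup cs q

ReducibleAt : ℕ → ℕ → Set
ReducibleAt t q = Reducible (3 ^ t + (2 + 3 * q))

-- Proof by reflection. For concrete t and N the `True` argument evaluates to the unit type, so it
-- can be given as `_`. The same entries are tested afresh for each t.
reducible-below : ∀ t N → True (allUpTo? (λ q → valid? (certificateAt q) (3 ^ t) (2 + 3 * q)) N) →
  ∀ q → q < N → ReducibleAt t q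
reducible-below t N checked q q<N =
  valid⇒reducible (certificateAt q) (3 ^ t) (2 + 3 * q) (toWitness checked q<N)

-- For t ≥ 1 exactly (3^(t - 1) - 1) / 2 indices q satisfy 2 * (2 + 3 * q) < 3^t; this gives the
-- bounds 1, 4, 13 and 40 for t = 2, 3, 4 and 5.
reducible-9 : ∀ q → q < 1 → ReducibleAt 2 q
reducible-9 = reducible-below 2 1 _

reducible-27 : ∀ q → q < 4 → ReducibleAt 3 q
reducible-27 = reducible-below 3 4 _

reducible-81 : ∀ q → q < 13 → ReducibleAt 4 q
reducible-81 = reducible-below 4 13 _

reducible-243 : ∀ q → q < 40 → ReducibleAt 5 q
reducible-243 = reducible-below 5 40 _

-- Of the 121 indices possible for t = 6, these are the ones with 729 + 2 + 3 * q < 845.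
reducible-729 : ∀ q → q < 38 → ReducibleAt 6 q
reducible-729 = reducible-below 6 38 _

-- Position of n between powers of 3, and the case distinction.

3^-bracket : ∀ n → 1 ≤ n → ∃[ t ] 3 ^ t ≤ n × n < 3 ^ suc t
3^-bracket 1             _ = 0 , ≤-refl , s≤s (s≤s z≤n)
3^-bracket (suc (suc n)) _ with 3^-bracket (suc n) (s≤s z≤n)
... | t , lower , upper with suc (suc n) <? 3 ^ suc t
...   | yes below = t , m≤n⇒m≤1+n lower , below
...   | no  above = suc t , ≮⇒≥ above , ≤-<-trans upper (^-monoʳ-< 3 (s≤s (s≤s z≤n)) (n<1+n (suc t)))

3^-odd : ∀ t → ∃[ h ] 3 ^ t ≡ suc (2 * h)
3^-odd zero    = 0 , refl
3^-odd (suc t) with 3^-odd t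
... | h , eq = 1 + 3 * h , trans (cong (3 *_) eq) (lemma h)
  where
  lemma : ∀ h → 3 * suc (2 * h) ≡ suc (2 * (1 + 3 * h))
  lemma = solve-∀

-- The segment from S - n to n is stable under x ↦ S - x, which has no fixed point since S is odd.
-- So m = S - 1 - n; in terms of k = n - h - 1 this is h - k - 1, and n < S makes it a natural
-- number.
reducible-upper : ∀ {S h n} → IsPowerOf3 S → S ≡ suc (2 * h) → h < n → n < S → Reducible n
reducible-upper {h = h} power refl h<n n<S with m≤n⇒∃[o]m+o≡n h<n
... | k , refl with m≤n⇒∃[o]m+o≡n (subst (k <_) (+-identityʳ h) (+-cancelˡ-< h k (h + 0) (s<s⁻¹ n<S)))
...   | m , refl =
  m , 2 * suc k , s≤s z≤n , size m k ,
  reduction-pairs m (suc k) (subst IsPowerOf3 (cong (λ h → suc (2 * h)) (+-comm (suc k) m)) power)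
  where
  size : ∀ m k → suc (suc k + m + k) ≡ m + 2 * suc k
  size = solve-∀

reducible-≡0 : ∀ {B} q → IsPowerOf3 B → q * 3 < B → Reducible (B + q * 3)
-- The witness m = B - 1 - d is the last number below the symmetric range around B. For q = 0 the
-- reduction removes just the singleton B.
reducible-≡0 q power d<B with m≤n⇒∃[o]m+o≡n d<B
... | m , refl =
  m , _ , subst (0 <_) (6q+1 q) (s≤s z≤n) , size m q ,
  reduction-≡0 m q (subst IsPowerOf3 (centre m q) power)
  where
  6q+1 : ∀ q → 1 + 6 * q ≡ q + (q + (q + suc (q + 2 * q)))
  6q+1 = solve-∀
  centre : ∀ m q → suc (q * 3 + m) ≡ suc m + q + q + q
  centre = solve-∀
  size : ∀ m q → suc (q * 3 + m) + q * 3 ≡ m + (q + (q + (q + suc (q + 2 * q))))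
  size = solve-∀

reducible-≡1 : ∀ {B} q → IsPowerOf3 B → 1 + q * 3 < B → Reducible (B + (1 + q * 3))
reducible-≡1 q power d<B with m≤n⇒∃[o]m+o≡n d<B
... | m , refl =
  m , _ , s≤s z≤n , size m q , reduction-≡1 m q (subst IsPowerOf3 (centre m q) power)
  where
  centre : ∀ m q → suc (1 + q * 3 + m) ≡ suc m + suc (2 * q) + q
  centre = solve-∀
  size : ∀ m q → suc (1 + q * 3 + m) + (1 + q * 3) ≡ m + (suc (2 * q) + (suc q + (q + (q + suc q))))
  size = solve-∀

-- The first hypothesis says that the index N is already too large for B, which is a closed
-- numerical check in each use.
quotient< : ∀ {B} N q → B ≤ 2 * (2 + 3 * N) → 2 * (2 + 3 * q) < B → q < N
quotient< N q B≤ <B = *-cancelˡ-< 3 q N (+-cancelˡ-< 2 (3 * q) (3 * N)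
  (*-cancelˡ-< 2 (2 + 3 * q) (2 + 3 * N) (<-≤-trans <B B≤)))

-- For t ≤ 1 there is no such q; for 2 ≤ t ≤ 5 the table covers all of them.
reducible-or-≥845 : ∀ t q → 2 * (2 + 3 * q) < 3 ^ t →
  ReducibleAt t q ⊎ (6 ≤ t × 845 ≤ 3 ^ t + (2 + 3 * q))
reducible-or-≥845 0 q d<B = contradiction (quotient< 0 q (s≤s z≤n) d<B) λ ()
reducible-or-≥845 1 q d<B = contradiction (quotient< 0 q (s≤s (s≤s (s≤s z≤n))) d<B) λ ()
reducible-or-≥845 2 q d<B = inj₁ (reducible-9 q (quotient< 1 q (≤ᵇ⇒≤ _ _ _) d<B))
reducible-or-≥845 3 q d<B = inj₁ (reducible-27 q (quotient< 4 q (≤ᵇ⇒≤ _ _ _) d<B))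
reducible-or-≥845 4 q d<B = inj₁ (reducible-81 q (quotient< 13 q (≤ᵇ⇒≤ _ _ _) d<B))
reducible-or-≥845 5 q d<B = inj₁ (reducible-243 q (quotient< 40 q (≤ᵇ⇒≤ _ _ _) d<B))
reducible-or-≥845 6 q d<B with q <? 38
... | yes q<38 = inj₁ (reducible-729 q q<38)
... | no  q≮38 = inj₂ (≤-refl , +-monoʳ-≤ 729 (+-monoʳ-≤ 2 (*-monoʳ-≤ 3 (≮⇒≥ q≮38))))
reducible-or-≥845 (suc (suc (suc (suc (suc (suc (suc t))))))) q d<B =
  inj₂ (m≤m+n 6 (suc t) , ≤-trans (≤-trans (≤ᵇ⇒≤ 845 (3 ^ 7) _) (^-monoʳ-≤ 3 (m≤m+n 7 t))) (m≤m+n _ _))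

reducible-or-exceptional : ∀ n → 1 ≤ n → Reducible n ⊎ (n ≥ 845 × n ∈ Nₒ)
reducible-or-exceptional n 1≤n with 3^-bracket n 1≤n
... | t , B≤n , n<3B with 3^-odd (suc t)
...   | h , 3B≡ with h <? n
-- Since 3 * B = 2 * h + 1, comparing h with n decides whether 3 * B < 2 * n.
...     | yes h<n = inj₁ (reducible-upper (suc t , refl) 3B≡ h<n n<3B)
...     | no  h≮n with m≤n⇒∃[o]m+o≡n B≤n
...       | d , refl = by-residue (d divMod 3)
  where
  B = 3 ^ t

  2d<B : 2 * d < B
  2d<B = +-cancelˡ-< (2 * B) (2 * d) B (begin-strict
    2 * B + 2 * d  ≡⟨ *-distribˡ-+ 2 B d ⟨
    2 * (B + d)    ≤⟨ *-monoʳ-≤ 2 (≮⇒≥ h≮n) ⟩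
    2 * h          <⟨ n<1+n _ ⟩
    suc (2 * h)    ≡⟨ 3B≡ ⟨
    3 * B          ≡⟨ +-comm B (2 * B) ⟩
    2 * B + B      ∎)
    where open ≤-Reasoning

  d<B : d < B
  d<B = ≤-<-trans (m≤n*m d 2) 2d<B

  -- This makes the upper bound in `Nₒ` say n < h + 1, which is exactly the failure of h < n.
  half : (3 ^ (t + 1) + 1) / 2 ≡ suc h
  half = begin
    (3 ^ (t + 1) + 1) / 2  ≡⟨ cong (λ e → (3 ^ e + 1) / 2) (+-comm t 1) ⟩
    (3 ^ suc t + 1) / 2    ≡⟨ cong (λ S → (S + 1) / 2) 3B≡ ⟩
    (suc (2 * h) + 1) / 2  ≡⟨ cong (_/ 2) (double h) ⟩
    suc h * 2 / 2          ≡⟨ m*n/n≡m (suc h) 2 ⟩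
    suc h                  ∎
    where
    open ≡-Reasoning
    double : ∀ h → suc (2 * h) + 1 ≡ suc h * 2
    double = solve-∀

  exceptional : ∀ q → d ≡ 2 + 3 * q → 6 ≤ t → B + d ∈ Nₒ
  exceptional q d≡ 6≤t =
    residue t (≤-trans (s≤s z≤n) 6≤t) ,
    t , ≤-trans (m≤m+n 4 2) 6≤t ,
    -- The strict lower bound 3^t + 1 < n amounts to d ≥ 2, which holds as d = 2 + 3 * q.
    +-monoʳ-< B (subst (1 <_) (sym d≡) (s≤s (s≤s z≤n))) ,
    subst (B + d <_) (sym half) (s≤s (≮⇒≥ h≮n))
    where
    residue : ∀ t → 1 ≤ t → (3 ^ t + d) % 3 ≡ 2
    residue (suc t) _ = begin
      (3 * 3 ^ t + d) % 3             ≡⟨ cong (λ d → (3 * 3 ^ t + d) % 3) d≡ ⟩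
      (3 * 3 ^ t + (2 + 3 * q)) % 3   ≡⟨ cong (_% 3) (regroup (3 ^ t) q) ⟩
      (2 + (3 ^ t + q) * 3) % 3       ≡⟨ [m+kn]%n≡m%n 2 (3 ^ t + q) 3 ⟩
      2                               ∎
      where
      open ≡-Reasoning
      regroup : ∀ x q → 3 * x + (2 + 3 * q) ≡ 2 + (x + q) * 3
      regroup = solve-∀

  by-residue : DivMod d 3 → Reducible (B + d) ⊎ (B + d ≥ 845 × B + d ∈ Nₒ)
  by-residue (result q 0F d≡) = inj₁ (subst (Reducible ∘ (B +_)) (sym d≡)
    (reducible-≡0 q (t , refl) (subst (_< B) d≡ d<B)))
  by-residue (result q 1F d≡) = inj₁ (subst (Reducible ∘ (B +_)) (sym d≡)
    (reducible-≡1 q (t , refl) (subst (_< B) d≡ d<B)))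
  by-residue (result q 2F d≡) with d≡′ ← trans d≡ (cong (2 +_) (*-comm q 3))
    with reducible-or-≥845 t q (subst (λ d → 2 * d < B) d≡′ 2d<B)
  ... | inj₁ red           = inj₁ (subst (Reducible ∘ (B +_)) (sym d≡′) red)
  ... | inj₂ (6≤t , 845≤n) =
    inj₂ (subst (λ d → 845 ≤ B + d) (sym d≡′) 845≤n , exceptional q d≡′ 6≤t)

theorem1 : ∀ (n : ℕ) → IsSmallestPositive AdmitsNo3GoodPartition n → n ≥ 845 × n ∈ Nₒ
theorem1 n least with reducible-or-exceptional n (IsSmallestPositive.positive least)
... | inj₁ reducible   = contradiction reducible (smallest-irreducible least)
... | inj₂ exceptional = exceptional
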